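{- Let $n\ge 3$ and let $BW_n$ be the gear graph on $2n+1$ vertices. Then $\varphi(BW_n^2)=\frac{1}{2}[(n+1)^2+5]$ if $n$ is even and $\frac{1}{2}(n+1)^2$ if $n$ is odd; $\varphi(BW_n^3)=n(n+1)$ if $n$ is even and $\frac{1}{2}(2n^2+3n+3)$ if $n$ is odd; $\varphi(BW_n^4)=n(2n-1)$.
   Context: All graphs are finite, simple and without isolated vertices. $\mathbb{N}_0$ denotes the set of non-negative integers; for finite $A,B\subseteq\mathbb{N}_0$, $A+B=\{a+b: a\in A, b\in B\}$. An integer additive set-indexer (IASI) of a graph $G$ is an injective map $f$ from $V(G)$ to the finite non-empty subsets of $\mathbb{N}_0$ such that the induced edge map $f^+(uv)=f(u)+f(v)$ is injective on $E(G)$. A weak IASI (WIASI) is an IASI $f$ with $|f^+(uv)|=\max(|f(u)|,|f(v)|)$ for every edge $uv$ (equivalently, for every edge at least one end vertex has a singleton label). A vertex or edge is mono-indexed if its set-label has cardinality $1$. Every graph admits a WIASI. The sparing number $\varphi(G)$ is the minimum, over all WIASIs of $G$, of the number of mono-indexed edges of $G$. The $r$-th power $G^r$ has vertex set $V(G)$, two distinct vertices being adjacent iff their distance in $G$ is at most $r$. The gear graph (bipartite wheel) $BW_n$ is obtained from the wheel $C_n+K_1$ (hub $u$, rim cycle $v_1v_2\cdots v_nv_1$) by inserting a new vertex $w_i$ on each rim edge $v_iv_{i+1}$ (indices mod $n$); thus $u$ is adjacent to each $v_i$, and $w_i$ is adjacent exactly to $v_i$ and $v_{i+1}$. -}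

module Defs where

open import Data.Empty using (⊥)
open import Data.Fin using (Fin; toℕ)
import Data.Fin as Fin
import Data.Fin.Properties as Finₚ
open import Data.List
  using (List; []; _∷_; _++_; map; filter; length; allFin; deduplicate; cartesianProductWith)
open import Data.List.Membership.Propositional using (_∈_; lose)
open import Data.List.Membership.Propositional.Properties
  using (∈-map⁺; ∈-map⁻; ∈-++⁺ˡ; ∈-++⁺ʳ; ∈-++⁻; ∈-allFin)
open import Data.List.Relation.Binary.BagAndSetEquality using (_∼[_]_; set)
import Data.List.Relation.Unary.All as All
open import Data.List.Relation.Unary.AllPairs using (_∷_)
open import Data.List.Relation.Unary.Any using (Any; any?; here; there; satisfied)
open import Data.List.Relation.Unary.Enumerates.Setoid using (IsEnumeration)
open import Data.List.Relation.Unary.Unique.Propositional using (Unique)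
import Data.List.Relation.Unary.Unique.Propositional.Properties as Uniqueₚ
open import Data.Nat using (ℕ; zero; suc; _+_; _≤_; _⊔_; z≤n; s≤s; NonZero; >-nonZero⁻¹)
open import Data.Nat.DivMod using (_mod_)
open import Data.Nat.Properties using (_≟_; anyUpTo?; allUpTo?; ≮⇒≥; <⇒≱)
open import Data.Product using (∃; ∃-syntax; _×_; _,_)
open import Data.Sum using (_⊎_; inj₁; inj₂)
open import Data.Unit using (⊤; tt)
open import Function using (_∘_)
open import Function.Definitions using (Injective)
open import Relation.Binary.Definitions using (Decidable; DecidableEquality; Symmetric)
open import Relation.Binary.PropositionalEquality using (_≡_; _≢_; refl; sym; cong; setoid)
open import Relation.Nullary using (¬_; Dec; yes; no; contradiction)
open import Relation.Nullary.Decidable using (map′; ¬?; _×-dec_; _⊎-dec_)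

------------------------------------------------------------------------
-- Graphs

record Graph : Set₁ where
  infix 4 _≟ᵥ_ _~_ _~?_
  field
    Vertex     : Set
    _≟ᵥ_       : DecidableEquality Vertex
    vertices   : List Vertex
    complete   : IsEnumeration (setoid Vertex) vertices
    unique     : Unique vertices
    _~_        : Vertex → Vertex → Set
    _~?_       : Decidable _~_
    ~-sym      : Symmetric _~_
    ~-irrefl   : ∀ v → ¬ (v ~ v)
    noIsolated : ∀ v → ∃[ w ] v ~ w

-- For a list without repetitions: each unordered pair of distinct
-- entries, listed once.
pairs : ∀ {A : Set} → List A → List (A × A)
pairs []       = []
pairs (x ∷ xs) = map (x ,_) xs ++ pairs xs

module _ (G : Graph) where
  open Graph G

  edges : List (Vertex × Vertex)
  edges = filter (λ (u , v) → u ~? v) (pairs vertices)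

  data Walk : ℕ → Vertex → Vertex → Set where
    nil  : ∀ {u} → Walk zero u u
    cons : ∀ {k u w v} → u ~ w → Walk k w v → Walk (suc k) u v

  -- d is the length of a shortest walk from u to v; no such d exists
  -- when u and v lie in different components.
  IsDistance : Vertex → Vertex → ℕ → Set
  IsDistance u v d = Walk d u v × (∀ k → Walk k u v → d ≤ k)

  PowerAdj : ℕ → Vertex → Vertex → Set
  PowerAdj r u v = u ≢ v × ∃[ d ] (d ≤ r × IsDistance u v d)

  walk? : ∀ k → Decidable (Walk k)
  walk? zero u v = map′ (λ { refl → nil }) (λ { nil → refl }) (u ≟ᵥ v)
  walk? (suc k) u v =
    map′ from to (any? (λ w → (u ~? w) ×-dec walk? k w v) vertices)
    where
    from : Any (λ w → u ~ w × Walk k w v) vertices → Walk (suc k) u v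
    from p = let (w , e , q) = satisfied p in cons e q

    to : Walk (suc k) u v → Any (λ w → u ~ w × Walk k w v) vertices
    to (cons {w = w} e q) = lose (complete w) (e , q)

  isDistance? : ∀ u v d → Dec (IsDistance u v d)
  isDistance? u v d =
    map′ (λ (p , m) → p , λ k q → ≮⇒≥ (λ k<d → m k<d q))
         (λ (p , m) → p , λ {k} k<d q → <⇒≱ k<d (m k q))
         (walk? d u v ×-dec allUpTo? (λ k → ¬? (walk? k u v)) d)

  powerAdj? : ∀ r → Decidable (PowerAdj r)
  powerAdj? r u v =
    ¬? (u ≟ᵥ v) ×-dec
    map′ (λ { (d , s≤s d≤r , p) → d , d≤r , p })
         (λ (d , d≤r , p) → d , s≤s d≤r , p)
         (anyUpTo? (isDistance? u v) (suc r))

  snoc : ∀ {k u w v} → Walk k u w → w ~ v → Walk (suc k) u v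
  snoc nil        e = cons e nil
  snoc (cons f p) e = cons f (snoc p e)

  reverseWalk : ∀ {k u v} → Walk k u v → Walk k v u
  reverseWalk nil        = nil
  reverseWalk (cons e p) = snoc (reverseWalk p) (~-sym e)

  ~⇒≢ : ∀ {u v} → u ~ v → u ≢ v
  ~⇒≢ {u} e refl = ~-irrefl u e

  ~⇒IsDistance1 : ∀ {u v} → u ~ v → IsDistance u v 1
  ~⇒IsDistance1 e = cons e nil , λ where
    zero    nil → contradiction refl (~⇒≢ e)
    (suc k) _   → s≤s z≤n

-- The r-th power of G, for r ≥ 1.
_^ᴳ_ : Graph → (r : ℕ) → .{{NonZero r}} → Graph
G ^ᴳ r = record
  { Vertex     = Vertex
  ; _≟ᵥ_       = _≟ᵥ_
  ; vertices   = vertices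
  ; complete   = complete
  ; unique     = unique
  ; _~_        = PowerAdj G r
  ; _~?_       = powerAdj? G r
  ; ~-sym      = λ (u≢v , d , d≤r , p , m) →
                   u≢v ∘ sym , d , d≤r , reverseWalk G p , λ k q → m k (reverseWalk G q)
  ; ~-irrefl   = λ v (v≢v , _) → v≢v refl
  ; noIsolated = λ v → let (w , e) = noIsolated v in
                   w , ~⇒≢ G e , 1 , >-nonZero⁻¹ r , ~⇒IsDistance1 G e
  }
  where open Graph G

infixl 8 _^ᴳ_

------------------------------------------------------------------------
-- Integer additive set-indexers

-- A list stands for the finite set of its entries: equality of sets is
-- _∼[ set ]_, and repetitions are not counted in the cardinality.
FinSet : Set
FinSet = List ℕ

card : FinSet → ℕ
card A = length (deduplicate _≟_ A)

infixl 6 _⊕_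

_⊕_ : FinSet → FinSet → FinSet
_⊕_ = cartesianProductWith _+_

module _ (G : Graph) where
  open Graph G

  SameEdge : Vertex → Vertex → Vertex → Vertex → Set
  SameEdge u v u′ v′ = (u ≡ u′ × v ≡ v′) ⊎ (u ≡ v′ × v ≡ u′)

  record IsIASI (f : Vertex → FinSet) : Set where
    field
      nonEmpty      : ∀ v → f v ≢ []
      injective     : Injective _≡_ _∼[ set ]_ f
      edgeInjective : ∀ {u v u′ v′} → u ~ v → u′ ~ v′ →
                      f u ⊕ f v ∼[ set ] f u′ ⊕ f v′ → SameEdge u v u′ v′

  record IsWIASI (f : Vertex → FinSet) : Set where
    field
      isIASI : IsIASI f
      weak   : ∀ {u v} → u ~ v → card (f u ⊕ f v) ≡ card (f u) ⊔ card (f v)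

  monoIndexedEdges : (Vertex → FinSet) → List (Vertex × Vertex)
  monoIndexedEdges f = filter (λ (u , v) → card (f u ⊕ f v) ≟ 1) (edges G)

  IsSparingNumber : ℕ → Set
  IsSparingNumber φ =
    (∃[ f ] IsWIASI f × length (monoIndexedEdges f) ≡ φ) ×
    (∀ f → IsWIASI f → φ ≤ length (monoIndexedEdges f))

------------------------------------------------------------------------
-- Gear graphs

-- hub is u, rim i is vᵢ and mid i is wᵢ, with indices 0, …, n - 1.
data GearVertex (n : ℕ) : Set where
  hub : GearVertex n
  rim : Fin n → GearVertex n
  mid : Fin n → GearVertex n

-- i + 1 modulo n
next : ∀ {n} → Fin n → Fin n
next {suc n} i = suc (toℕ i) mod suc n

GearAdj : ∀ {n} → GearVertex n → GearVertex n → Set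
GearAdj hub     (rim _) = ⊤
GearAdj (rim _) hub     = ⊤
GearAdj (rim i) (mid j) = i ≡ j ⊎ i ≡ next j
GearAdj (mid j) (rim i) = i ≡ j ⊎ i ≡ next j
GearAdj hub     hub     = ⊥
GearAdj hub     (mid _) = ⊥
GearAdj (mid _) hub     = ⊥
GearAdj (rim _) (rim _) = ⊥
GearAdj (mid _) (mid _) = ⊥

gearAdj? : ∀ {n} → Decidable (GearAdj {n})
gearAdj? hub     (rim _) = yes tt
gearAdj? (rim _) hub     = yes tt
gearAdj? (rim i) (mid j) = (i Finₚ.≟ j) ⊎-dec (i Finₚ.≟ next j)
gearAdj? (mid j) (rim i) = (i Finₚ.≟ j) ⊎-dec (i Finₚ.≟ next j)
gearAdj? hub     hub     = no λ ()
gearAdj? hub     (mid _) = no λ ()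
gearAdj? (mid _) hub     = no λ ()
gearAdj? (rim _) (rim _) = no λ ()
gearAdj? (mid _) (mid _) = no λ ()

gearAdj-sym : ∀ {n} → Symmetric (GearAdj {n})
gearAdj-sym {x = hub}   {rim _} e = e
gearAdj-sym {x = rim _} {hub}   e = e
gearAdj-sym {x = rim _} {mid _} e = e
gearAdj-sym {x = mid _} {rim _} e = e

gearAdj-irrefl : ∀ {n} (x : GearVertex n) → ¬ GearAdj x x
gearAdj-irrefl hub     ()
gearAdj-irrefl (rim _) ()
gearAdj-irrefl (mid _) ()

rim-injective : ∀ {n} {i j : Fin n} → rim i ≡ rim j → i ≡ j
rim-injective refl = refl

mid-injective : ∀ {n} {i j : Fin n} → mid i ≡ mid j → i ≡ j
mid-injective refl = refl

infix 4 _≟ᵍ_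

_≟ᵍ_ : ∀ {n} → DecidableEquality (GearVertex n)
hub   ≟ᵍ hub   = yes refl
rim i ≟ᵍ rim j = map′ (cong rim) rim-injective (i Finₚ.≟ j)
mid i ≟ᵍ mid j = map′ (cong mid) mid-injective (i Finₚ.≟ j)
hub   ≟ᵍ rim _ = no λ ()
hub   ≟ᵍ mid _ = no λ ()
rim _ ≟ᵍ hub   = no λ ()
rim _ ≟ᵍ mid _ = no λ ()
mid _ ≟ᵍ hub   = no λ ()
mid _ ≟ᵍ rim _ = no λ ()

gearVertices : ∀ n → List (GearVertex n)
gearVertices n = hub ∷ map rim (allFin n) ++ map mid (allFin n)

gearVertices-complete : ∀ n → IsEnumeration (setoid (GearVertex n)) (gearVertices n)
gearVertices-complete n hub     = here refl
gearVertices-complete n (rim i) = there (∈-++⁺ˡ (∈-map⁺ rim (∈-allFin i)))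
gearVertices-complete n (mid i) =
  there (∈-++⁺ʳ (map rim (allFin n)) (∈-map⁺ mid (∈-allFin i)))

gearVertices-unique : ∀ n → Unique (gearVertices n)
gearVertices-unique n =
  All.tabulate hub∉ ∷
  Uniqueₚ.++⁺ (Uniqueₚ.map⁺ rim-injective (Uniqueₚ.allFin⁺ n))
              (Uniqueₚ.map⁺ mid-injective (Uniqueₚ.allFin⁺ n))
              disjoint
  where
  disjoint : ∀ {x} → ¬ (x ∈ map rim (allFin n) × x ∈ map mid (allFin n))
  disjoint (p , q) with ∈-map⁻ rim p | ∈-map⁻ mid q
  ... | _ , _ , refl | _ , _ , ()

  hub∉ : ∀ {x} → x ∈ map rim (allFin n) ++ map mid (allFin n) → hub ≢ x
  hub∉ p refl with ∈-++⁻ (map rim (allFin n)) p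
  ... | inj₁ q with () ← ∈-map⁻ rim q
  ... | inj₂ q with () ← ∈-map⁻ mid q

gear : (n : ℕ) → 3 ≤ n → Graph
gear n n≥3 = record
  { Vertex     = GearVertex n
  ; _≟ᵥ_       = _≟ᵍ_
  ; vertices   = gearVertices n
  ; complete   = gearVertices-complete n
  ; unique     = gearVertices-unique n
  ; _~_        = GearAdj
  ; _~?_       = gearAdj?
  ; ~-sym      = λ {x} {y} → gearAdj-sym {x = x} {y}
  ; ~-irrefl   = gearAdj-irrefl
  ; noIsolated = neighbour n≥3
  }
  where
  neighbour : ∀ {n} → 3 ≤ n → (x : GearVertex n) → ∃[ y ] GearAdj x y
  neighbour (s≤s _) hub     = rim Fin.zero , tt
  neighbour _       (rim _) = hub , tt
  neighbour _       (mid i) = rim i , inj₁ refl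

{-# OPTIONS --safe #-}

-- In a weak IASI the vertices whose labels are not singletons form an
-- independent set S, and an edge is mono-indexed iff it avoids S, so the number
-- of mono-indexed edges is |E| minus the degree sum of S. Conversely every
-- independent set S arises: give v the label {b} or {b, b + 1} with b = 2 ^ rank v.
-- The sparing number is thus |E| minus the maximal degree sum of an independent
-- set. For BWₙ^r this maximum follows from clique inequalities (with a parity
-- correction), and is attained by v₀ and ⌊(n - 1) / 2⌋ of the wᵢ for r = 2, by
-- ⌊n / 2⌋ of the wᵢ for r = 3, and by the hub for r = 4.
module Submission where

open import Defs
open import Algebra.Properties.CommutativeSemigroup using (interchange)
open import Data.Bool using (Bool; true; false; not; if_then_else_)
open import Data.Bool.Properties using (not-¬; ¬-not; not-involutive)
open import Data.Fin using (Fin; toℕ; fromℕ; fromℕ<; inject₁)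
open import Data.Fin.Permutation using (permutation)
import Data.Fin.Properties as Finₚ
open import Data.Fin.Relation.Unary.Top using (view; ‵fromℕ; ‵inject₁)
open import Data.List
  using (List; []; _∷_; _++_; map; filter; length; deduplicate; lookup; allFin; tabulate)
open import Data.List.Extrema.Nat using (max; argmax-sel; ⊥≤max; xs≤max)
open import Data.List.Membership.Propositional using (_∈_)
open import Data.List.Membership.Propositional.Properties
  using (∈-lookup; ∈-map⁻; ∈-deduplicate⁺; ∈-deduplicate⁻;
         ∈-cartesianProductWith⁺; ∈-cartesianProductWith⁻)
import Data.List.Membership.Setoid.Properties as Membership
open import Data.List.Properties using (length-map; map-∘; filter-accept)
open import Data.List.Relation.Binary.BagAndSetEquality using (_∼[_]_; set)
open import Data.List.Relation.Binary.Subset.Propositional using (_⊆_)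
open import Data.List.Relation.Unary.All as All using (All; []; _∷_)
import Data.List.Relation.Unary.All.Properties as Allₚ
open import Data.List.Relation.Unary.AllPairs as AllPairs using (AllPairs; []; _∷_)
import Data.List.Relation.Unary.AllPairs.Properties as AllPairsₚ
open import Data.List.Relation.Unary.Any using (here; there; index)
open import Data.List.Relation.Unary.Unique.DecPropositional.Properties using (deduplicate-!)
open import Data.List.Relation.Unary.Unique.Propositional using (Unique)
import Data.List.Relation.Unary.Unique.Propositional.Properties as Uniqueₚ
open import Data.Nat
open import Data.Nat.Divisibility using (_∣_; _∤_; divides; ∣-refl; ∣m∣n⇒∣m+n; ∣m⇒∣m*n; m∣m*n)
open import Data.Nat.DivMod using (m<n⇒m%n≡m; n%n≡0; m%n<n)
open import Data.Nat.ListAction using (sum)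
open import Data.Nat.Properties
open import Data.Nat.Tactic.RingSolver using (solve-∀)
open import Data.Product using (∃₂; ∃-syntax; _×_; _,_; proj₁; proj₂; uncurry)
open import Data.Sum using (_⊎_; inj₁; inj₂; [_,_]′)
open import Data.Unit using (tt)
open import Function using (_∘_; id)
open import Function.Bundles using (_⇔_; Equivalence; mk⇔)
open import Relation.Binary.Definitions using (tri<; tri≈; tri>)
open import Relation.Binary.PropositionalEquality
  using (_≡_; _≢_; refl; sym; trans; cong; cong₂; subst; subst₂; setoid; module ≡-Reasoning)
open import Relation.Nullary using (¬_; Dec; yes; no; does; contradiction)
open import Relation.Nullary.Decidable using (dec-true; dec-false; ¬?)
open import Algebra.Properties.Semiring.Sum +-*-semiring
  using (∑-distrib-+; sum-cong-≗; *-distribʳ-sum; sum-permute)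
  renaming (sum to ∑ᶠ)

-- Degrees in each power are constant on the hub, the rim vertices and the middle vertices, so the
-- degree sum of a set depends only on the triple of numbers (h, R, M) of its members of each kind.
-- The upper bounds are linear programming certificates: twice the degree sum plus a nonnegative
-- slack is a nonnegative combination of clique inequalities, and the claimed optimum attains the
-- bound. Cliques running around the cycle contain each middle vertex twice, so they bound `2 * M`
-- and admit half-integral solutions, which parity must exclude. In the square the chosen rim vertex
-- leaves n - 1 for `2 * M`, so the correction is needed for even n; in the cube no rim vertex is
-- chosen, and it is needed for odd n. The hypothesis n ≥ 3 enters the bounds through q = n - 3: in
-- the square a rim vertex has degree n - 3 more than a middle vertex, and in the cube the hub has
-- degree n - 3 more than a single middle vertex, so that for n = 3 the two tie.

private
  variable
    A B : Set

-- Indicators of decidable properties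

χ : Bool → ℕ
χ b = if b then 1 else 0

𝟙 : {P : Set} → Dec P → ℕ
𝟙 P? = χ (does P?)

𝟙-cong : {P Q : Set} (P? : Dec P) (Q? : Dec Q) → P ⇔ Q → 𝟙 P? ≡ 𝟙 Q?
𝟙-cong (yes p) Q? P⇔Q = cong χ (sym (dec-true Q? (Equivalence.to P⇔Q p)))
𝟙-cong (no ¬p) Q? P⇔Q = cong χ (sym (dec-false Q? (¬p ∘ Equivalence.from P⇔Q)))

-- Finite sums over lists

∑ : List A → (A → ℕ) → ℕ
∑ xs f = sum (map f xs)

∑-cong : {f g : A → ℕ} → (∀ x → f x ≡ g x) → ∀ xs → ∑ xs f ≡ ∑ xs g
∑-cong f≗g []       = refl
∑-cong f≗g (x ∷ xs) = cong₂ _+_ (f≗g x) (∑-cong f≗g xs)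

∑-zero : {f : A → ℕ} → ∀ {xs} → All (λ x → f x ≡ 0) xs → ∑ xs f ≡ 0
∑-zero []         = refl
∑-zero (eq ∷ eqs) = cong₂ _+_ eq (∑-zero eqs)

∑-+ : (f g : A → ℕ) → ∀ xs → ∑ xs (λ x → f x + g x) ≡ ∑ xs f + ∑ xs g
∑-+ f g []       = refl
∑-+ f g (x ∷ xs) = trans (cong (f x + g x +_) (∑-+ f g xs)) (interchange +-commutativeSemigroup (f x) (g x) (∑ xs f) (∑ xs g))

∑-*ˡ : ∀ c (f : A → ℕ) xs → ∑ xs (λ x → c * f x) ≡ c * ∑ xs f
∑-*ˡ c f []       = sym (*-zeroʳ c)
∑-*ˡ c f (x ∷ xs) = trans (cong (c * f x +_) (∑-*ˡ c f xs)) (sym (*-distribˡ-+ c (f x) _))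

∑-++ : (f : A → ℕ) → ∀ xs ys → ∑ (xs ++ ys) f ≡ ∑ xs f + ∑ ys f
∑-++ f []       ys = refl
∑-++ f (x ∷ xs) ys = trans (cong (f x +_) (∑-++ f xs ys)) (sym (+-assoc (f x) _ _))

∑-map : (g : A → B) (f : B → ℕ) → ∀ xs → ∑ (map g xs) f ≡ ∑ xs (f ∘ g)
∑-map g f xs = cong sum (sym (map-∘ xs))

-- Handshake principle: the ordered pairs off the diagonal are the two orientations of the unordered
-- ones. With `h` the adjacency indicator it counts edges by degrees; weighted by `S` it counts the
-- edge ends in `S`.
∑-pairs : (h : A → A → ℕ) → (∀ x → h x x ≡ 0) → ∀ xs →
          ∑ (pairs xs) (λ (x , y) → h x y + h y x) ≡ ∑ xs (λ x → ∑ xs (h x))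
∑-pairs h h-diag []       = refl
∑-pairs h h-diag (x ∷ xs) = begin
  ∑ (map (x ,_) xs ++ pairs xs) sym-h
    ≡⟨ ∑-++ sym-h (map (x ,_) xs) (pairs xs) ⟩
  ∑ (map (x ,_) xs) sym-h + ∑ (pairs xs) sym-h
    ≡⟨ cong₂ _+_ (trans (∑-map (x ,_) sym-h xs) (∑-+ (h x) (λ y → h y x) xs)) (∑-pairs h h-diag xs) ⟩
  ∑ xs (h x) + ∑ xs (λ y → h y x) + ∑ xs (λ y → ∑ xs (h y))
    ≡⟨ +-assoc (∑ xs (h x)) _ _ ⟩
  ∑ xs (h x) + (∑ xs (λ y → h y x) + ∑ xs (λ y → ∑ xs (h y)))
    ≡⟨ cong₂ _+_ (cong (_+ ∑ xs (h x)) (h-diag x)) (∑-+ (λ y → h y x) (λ y → ∑ xs (h y)) xs) ⟨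
  h x x + ∑ xs (h x) + ∑ xs (λ y → h y x + ∑ xs (h y)) ∎
  where
  open ≡-Reasoning
  sym-h = λ (x , y) → h x y + h y x

length-filter-filter : {P Q : A → Set} (P? : ∀ x → Dec (P x)) (Q? : ∀ x → Dec (Q x)) → ∀ xs →
                       length (filter Q? (filter P? xs)) ≡ ∑ xs (λ x → 𝟙 (P? x) * 𝟙 (Q? x))
length-filter-filter P? Q? []       = refl
length-filter-filter P? Q? (x ∷ xs) with P? x
... | no  _ = length-filter-filter P? Q? xs
... | yes _ with Q? x
...   | no  _ = length-filter-filter P? Q? xs
...   | yes _ = cong suc (length-filter-filter P? Q? xs)

-- Cardinality of sumsets

lookup-injective : {xs : List A} → Unique xs → ∀ i j → lookup xs i ≡ lookup xs j → i ≡ j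
lookup-injective (_   ∷ _)   Fin.zero    Fin.zero    _  = refl
lookup-injective (x∉  ∷ _)   Fin.zero    (Fin.suc j) eq = contradiction eq (All.lookup x∉ (∈-lookup j))
lookup-injective (x∉  ∷ _)   (Fin.suc i) Fin.zero    eq = contradiction (sym eq) (All.lookup x∉ (∈-lookup i))
lookup-injective (_   ∷ xs!) (Fin.suc i) (Fin.suc j) eq = cong Fin.suc (lookup-injective xs! i j eq)

-- Pigeonhole principle, applied to the map sending a position in `xs` to the position of the same
-- entry in `ys`.
Unique-⊆⇒length≤ : {xs ys : List A} → Unique xs → xs ⊆ ys → length xs ≤ length ys
Unique-⊆⇒length≤ {A} {xs} {ys} xs! xs⊆ys =
  Finₚ.injective⇒≤ {f = λ i → index (position i)}
    (λ {i} {j} eq → lookup-injective xs! i j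
       (Membership.index-injective (setoid A) (position i) (position j) eq))
  where
  position : ∀ i → lookup xs i ∈ ys
  position i = xs⊆ys (∈-lookup i)

card-nonEmpty : ∀ {A} → A ≢ [] → 1 ≤ card A
card-nonEmpty {[]}    A≢[] = contradiction refl A≢[]
card-nonEmpty {_ ∷ _} _    = s≤s z≤n

card≢1⇒distinct : ∀ {A} → A ≢ [] → card A ≢ 1 → ∃₂ λ x y → x ∈ A × y ∈ A × x < y
card≢1⇒distinct {A} A≢[] |A|≢1
  with deduplicate _≟_ A | card-nonEmpty A≢[] | deduplicate-! _≟_ A | ∈-deduplicate⁻ _≟_ A
... | x ∷ []    | _ | _             | _  = contradiction refl |A|≢1
... | x ∷ y ∷ _ | _ | (x≢y ∷ _) ∷ _ | ∈A with <-cmp x y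
...   | tri< x<y _ _ = x , y , ∈A (here refl) , ∈A (there (here refl)) , x<y
...   | tri≈ _ x≡y _ = contradiction x≡y x≢y
...   | tri> _ _ y<x = y , x , ∈A (there (here refl)) , ∈A (here refl) , y<x

maximum : ∀ {A} → A ≢ [] → ∃[ m ] m ∈ A × All (_≤ m) A
maximum {[]}     A≢[] = contradiction refl A≢[]
maximum {x ∷ xs} _    = max x xs , max∈ (argmax-sel id x xs) , ⊥≤max x xs ∷ xs≤max x xs
  where
  max∈ : max x xs ≡ x ⊎ max x xs ∈ xs → max x xs ∈ x ∷ xs
  max∈ = [ here , there ]′

-- max A + y lies outside A + x when x < y.
card-<-sumset : ∀ {A C} x y → A ≢ [] → x < y →
                (∀ {a} → a ∈ A → a + x ∈ C × a + y ∈ C) → card A < card C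
card-<-sumset {A} {C} x y A≢[] x<y sums∈ = begin
  suc (card A)                                       ≡⟨ cong suc (length-map (_+ x) (deduplicate _≟_ A)) ⟨
  length (m + y ∷ map (_+ x) (deduplicate _≟_ A))    ≤⟨ Unique-⊆⇒length≤ (All.tabulate fresh ∷ translate!) sums⊆ ⟩
  card C                                             ∎
  where
  open ≤-Reasoning
  m = proj₁ (maximum A≢[])
  m∈A = proj₁ (proj₂ (maximum A≢[]))
  ≤m = proj₂ (proj₂ (maximum A≢[]))

  translate! = Uniqueₚ.map⁺ (+-cancelʳ-≡ x _ _) (deduplicate-! _≟_ A)

  fresh : ∀ {z} → z ∈ map (_+ x) (deduplicate _≟_ A) → m + y ≢ z
  fresh z∈ refl with a , a∈ , eq ← ∈-map⁻ (_+ x) z∈ =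
    <-irrefl (sym eq) (+-mono-≤-< (All.lookup ≤m (∈-deduplicate⁻ _≟_ A a∈)) x<y)

  sums⊆ : m + y ∷ map (_+ x) (deduplicate _≟_ A) ⊆ deduplicate _≟_ C
  sums⊆ (here refl) = ∈-deduplicate⁺ _≟_ (proj₂ (sums∈ m∈A))
  sums⊆ (there z∈) with a , a∈ , refl ← ∈-map⁻ (_+ x) z∈ =
    ∈-deduplicate⁺ _≟_ (proj₁ (sums∈ (∈-deduplicate⁻ _≟_ A a∈)))

-- If both sets had two elements, two translates of either one would fit into the sumset, which
-- would then be strictly larger than both sets and hence than the maximum required by weakness.
weak⇒card≡1 : ∀ {A B} → A ≢ [] → B ≢ [] → card (A ⊕ B) ≡ card A ⊔ card B →
              card A ≢ 1 → card B ≡ 1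
weak⇒card≡1 {A} {B} A≢[] B≢[] weak |A|≢1 with card B ≟ 1
... | yes |B|≡1 = |B|≡1
... | no  |B|≢1
  with a , a′ , a∈ , a′∈ , a<a′ ← card≢1⇒distinct A≢[] |A|≢1
     | b , b′ , b∈ , b′∈ , b<b′ ← card≢1⇒distinct B≢[] |B|≢1 =
  contradiction (sym weak) (<⇒≢ (⊔-lub
    (card-<-sumset b b′ A≢[] b<b′ λ c∈ → ∈-⊕ c∈ b∈ , ∈-⊕ c∈ b′∈)
    (card-<-sumset a a′ B≢[] a<a′ λ c∈ →
       subst (_∈ A ⊕ B) (+-comm a _) (∈-⊕ a∈ c∈) , subst (_∈ A ⊕ B) (+-comm a′ _) (∈-⊕ a′∈ c∈))))
  where
  ∈-⊕ : ∀ {x y} → x ∈ A → y ∈ B → x + y ∈ A ⊕ B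
  ∈-⊕ = ∈-cartesianProductWith⁺ _+_

card-pair : ∀ {x y} → x ≢ y → card (x ∷ y ∷ []) ≡ 2
card-pair {x} {y} x≢y = cong (suc ∘ length) (filter-accept {P = x ≢_} (λ z → ¬? (x ≟ z)) {y} {[]} x≢y)

-- Least elements

Least : FinSet → ℕ → Set
Least A m = m ∈ A × (∀ {x} → x ∈ A → m ≤ x)

least-unique : ∀ {A B m k} → A ∼[ set ] B → Least A m → Least B k → m ≡ k
least-unique A∼B (m∈A , m≤) (k∈B , k≤) =
  ≤-antisym (m≤ (Equivalence.from A∼B k∈B)) (k≤ (Equivalence.to A∼B m∈A))

least-⊕ : ∀ {A B m k} → Least A m → Least B k → Least (A ⊕ B) (m + k)
least-⊕ {A} {B} {m} {k} (m∈A , m≤) (k∈B , k≤) = ∈-cartesianProductWith⁺ _+_ m∈A k∈B , m+k≤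
  where
  m+k≤ : ∀ {x} → x ∈ A ⊕ B → m + k ≤ x
  m+k≤ x∈ with a , b , a∈ , b∈ , refl ← ∈-cartesianProductWith⁻ _+_ A B x∈ = +-mono-≤ (m≤ a∈) (k≤ b∈)

2^-injective : ∀ {i j} → 2 ^ i ≡ 2 ^ j → i ≡ j
2^-injective {i} {j} eq with <-cmp i j
... | tri< i<j _ _ = contradiction eq (<⇒≢ (^-monoʳ-< 2 ≤-refl i<j))
... | tri≈ _ i≡j _ = i≡j
... | tri> _ _ j<i = contradiction (sym eq) (<⇒≢ (^-monoʳ-< 2 ≤-refl j<i))

-- The larger exponent decides: two powers with exponents i < j add up to less than `2 ^ suc j`,
-- which is at most `2 ^ l`, whatever the other exponent `k` is.
2^-sum-< : ∀ {i j l} k → i < j → j < l → 2 ^ i + 2 ^ j < 2 ^ k + 2 ^ l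
2^-sum-< {i} {j} {l} k i<j j<l = begin-strict
  2 ^ i + 2 ^ j   <⟨ +-monoˡ-< (2 ^ j) (^-monoʳ-< 2 ≤-refl i<j) ⟩
  2 ^ j + 2 ^ j   ≡⟨ cong (2 ^ j +_) (+-identityʳ (2 ^ j)) ⟨
  2 ^ suc j       ≤⟨ ^-monoʳ-≤ 2 j<l ⟩
  2 ^ l           ≤⟨ m≤n+m (2 ^ l) (2 ^ k) ⟩
  2 ^ k + 2 ^ l   ∎
  where open ≤-Reasoning

2^-sum-injective-< : ∀ {i j k l} → i < j → k < l → 2 ^ i + 2 ^ j ≡ 2 ^ k + 2 ^ l → i ≡ k × j ≡ l
2^-sum-injective-< {i} {j} {k} {l} i<j k<l eq with <-cmp j l
... | tri< j<l _ _  = contradiction eq (<⇒≢ (2^-sum-< k i<j j<l))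
... | tri> _ _ l<j  = contradiction (sym eq) (<⇒≢ (2^-sum-< i k<l l<j))
... | tri≈ _ refl _ = 2^-injective (+-cancelʳ-≡ (2 ^ j) _ _ eq) , refl

-- Uniqueness of a binary expansion with two ones. For edges the two exponents differ because
-- adjacent vertices have different ranks.
2^-sidon : ∀ {i j k l} → i ≢ j → k ≢ l → 2 ^ i + 2 ^ j ≡ 2 ^ k + 2 ^ l →
           (i ≡ k × j ≡ l) ⊎ (i ≡ l × j ≡ k)
2^-sidon {i} {j} {k} {l} i≢j k≢l eq with <-cmp i j | <-cmp k l
... | tri≈ _ i≡j _ | _            = contradiction i≡j i≢j
... | _            | tri≈ _ k≡l _ = contradiction k≡l k≢l
... | tri< i<j _ _ | tri< k<l _ _ = inj₁ (2^-sum-injective-< i<j k<l eq)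
... | tri< i<j _ _ | tri> _ _ l<k =
  inj₂ (2^-sum-injective-< i<j l<k (trans eq (+-comm (2 ^ k) _)))
... | tri> _ _ j<i | tri< k<l _ _ =
  let (p , q) = 2^-sum-injective-< j<i k<l (trans (+-comm (2 ^ j) _) eq) in inj₂ (q , p)
... | tri> _ _ j<i | tri> _ _ l<k =
  let (p , q) = 2^-sum-injective-< j<i l<k (trans (+-comm (2 ^ j) _) (trans eq (+-comm (2 ^ k) _))) in inj₁ (q , p)

-- Sparing numbers and independent sets

module _ (G : Graph) where
  open Graph G

  degree : Vertex → ℕ
  degree u = ∑ vertices (λ v → 𝟙 (u ~? v))

  Independent : (Vertex → Bool) → Set
  Independent S = ∀ {u v} → u ~ v → S u ≡ true → S v ≢ true

  weight : (Vertex → Bool) → ℕ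
  weight S = ∑ vertices (λ v → χ (S v) * degree v)

  -- The source of every upper bound below. Once a member of `S` is met, all later entries of the
  -- list are adjacent to it and contribute 0.
  clique-∑≤1 : ∀ {S} → Independent S → ∀ {vs} → AllPairs _~_ vs → ∑ vs (χ ∘ S) ≤ 1
  clique-∑≤1 ind []        = z≤n
  clique-∑≤1 {S} ind {v ∷ _} (v~ ∷ vs~) with S v in Sv
  ... | false = clique-∑≤1 ind vs~
  ... | true  = ≤-reflexive (cong suc (∑-zero (All.map (λ v~w → cong χ (¬-not (ind v~w Sv))) v~)))

  multiIndexed : (Vertex → FinSet) → Vertex → Bool
  multiIndexed f v = not (does (card (f v) ≟ 1))

  module _ {f : Vertex → FinSet} (wiasi : IsWIASI G f) where
    open IsWIASI wiasi
    open IsIASI isIASI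
    open ≡-Reasoning

    private
      S = multiIndexed f
      mono? = λ u v → card (f u ⊕ f v) ≟ 1

    -- Pairs the cardinality fact with the value of `S v`, so that one case split settles both.
    multiIndexed? : ∀ v → (card (f v) ≡ 1 × S v ≡ false) ⊎ (card (f v) ≢ 1 × S v ≡ true)
    multiIndexed? v = split (card (f v) ≟ 1)
      where
      split : (d : Dec (card (f v) ≡ 1)) →
              (card (f v) ≡ 1 × not (does d) ≡ false) ⊎ (card (f v) ≢ 1 × not (does d) ≡ true)
      split (yes eq) = inj₁ (eq , refl)
      split (no neq) = inj₂ (neq , refl)

    multiIndexed-independent : Independent S
    multiIndexed-independent {u} {v} u~v Su Sv with multiIndexed? u | multiIndexed? v
    ... | inj₁ (_ , Su′)    | _                 = contradiction Su (not-¬ Su′)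
    ... | inj₂ _            | inj₁ (_ , Sv′)    = contradiction Sv (not-¬ Sv′)
    ... | inj₂ (|fu|≢1 , _) | inj₂ (|fv|≢1 , _) =
      |fv|≢1 (weak⇒card≡1 (nonEmpty u) (nonEmpty v) (weak u~v) |fu|≢1)

    -- Two multi-indexed ends are excluded by independence. If one end is a singleton, weakness
    -- gives the sumset the cardinality of the other end, since that is at least 1.
    mono-edge : ∀ {u v} → u ~ v → 𝟙 (mono? u v) + (χ (S u) + χ (S v)) ≡ 1
    mono-edge {u} {v} u~v with multiIndexed? u | multiIndexed? v
    ... | inj₂ (_ , Su)       | inj₂ (_ , Sv)       = contradiction Sv (multiIndexed-independent u~v Su)
    ... | inj₁ (|fu|≡1 , Su)  | inj₁ (|fv|≡1 , Sv)  =
      cong₂ _+_ (cong χ (dec-true (mono? u v) (trans (weak u~v) (cong₂ _⊔_ |fu|≡1 |fv|≡1))))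
                (cong₂ (λ b c → χ b + χ c) Su Sv)
    ... | inj₁ (|fu|≡1 , Su)  | inj₂ (|fv|≢1 , Sv)  =
      cong₂ _+_ (cong χ (dec-false (mono? u v) λ eq → |fv|≢1 (trans (sym |fu⊕fv|) eq)))
                (cong₂ (λ b c → χ b + χ c) Su Sv)
      where
      |fu⊕fv| : card (f u ⊕ f v) ≡ card (f v)
      |fu⊕fv| = trans (weak u~v) (trans (cong (_⊔ card (f v)) |fu|≡1) (m≤n⇒m⊔n≡n (card-nonEmpty (nonEmpty v))))
    ... | inj₂ (|fu|≢1 , Su)  | inj₁ (|fv|≡1 , Sv)  =
      cong₂ _+_ (cong χ (dec-false (mono? u v) λ eq → |fu|≢1 (trans (sym |fu⊕fv|) eq)))
                (cong₂ (λ b c → χ b + χ c) Su Sv)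
      where
      |fu⊕fv| : card (f u ⊕ f v) ≡ card (f u)
      |fu⊕fv| = trans (weak u~v) (trans (cong (card (f u) ⊔_) |fv|≡1) (m≥n⇒m⊔n≡m (card-nonEmpty (nonEmpty u))))

    adjacency-sym : ∀ u v → 𝟙 (u ~? v) ≡ 𝟙 (v ~? u)
    adjacency-sym u v = 𝟙-cong (u ~? v) (v ~? u) (mk⇔ ~-sym ~-sym)

    -- Extends `mono-edge` to all pairs, where non-adjacent ones give 0. The last term has `v ~? u`
    -- so that the bracket has the shape `h u v + h v u` that `∑-pairs` expects.
    mono-pair : ∀ u v → 𝟙 (u ~? v) * 𝟙 (mono? u v) +
                (χ (S u) * 𝟙 (u ~? v) + χ (S v) * 𝟙 (v ~? u)) ≡ 𝟙 (u ~? v)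
    mono-pair u v rewrite adjacency-sym v u with u ~? v
    ... | yes u~v rewrite *-identityʳ (χ (S u)) | *-identityʳ (χ (S v)) | *-identityˡ (𝟙 (mono? u v)) =
      mono-edge u~v
    ... | no _ rewrite *-zeroʳ (χ (S u)) | *-zeroʳ (χ (S v)) = refl

    adjacency-diag : ∀ v → 𝟙 (v ~? v) ≡ 0
    adjacency-diag v = cong χ (dec-false (v ~? v) (~-irrefl v))

    -- Every edge is mono-indexed or has exactly one multi-indexed end.
    mono-count : 2 * length (monoIndexedEdges G f) + 2 * weight S ≡ ∑ vertices degree
    mono-count = begin
      2 * length (monoIndexedEdges G f) + 2 * weight S
        ≡⟨ *-distribˡ-+ 2 (length (monoIndexedEdges G f)) (weight S) ⟨
      2 * (length (monoIndexedEdges G f) + weight S)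
        ≡⟨ cong (2 *_) (cong₂ _+_
             (length-filter-filter (uncurry _~?_) (uncurry mono?) (pairs vertices)) weight-pairs) ⟩
      2 * (∑ (pairs vertices) (λ (u , v) → 𝟙 (u ~? v) * 𝟙 (mono? u v)) +
           ∑ (pairs vertices) (λ (u , v) → χ (S u) * 𝟙 (u ~? v) + χ (S v) * 𝟙 (v ~? u)))
        ≡⟨ cong (2 *_) (trans (sym (∑-+ _ _ (pairs vertices))) (∑-cong (uncurry mono-pair) (pairs vertices))) ⟩
      2 * ∑ (pairs vertices) (λ (u , v) → 𝟙 (u ~? v))
        ≡⟨ ∑-*ˡ 2 _ (pairs vertices) ⟨
      ∑ (pairs vertices) (λ (u , v) → 2 * 𝟙 (u ~? v))
        ≡⟨ ∑-cong (λ (u , v) → cong (𝟙 (u ~? v) +_) (trans (+-identityʳ _) (adjacency-sym u v))) (pairs vertices) ⟩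
      ∑ (pairs vertices) (λ (u , v) → 𝟙 (u ~? v) + 𝟙 (v ~? u))
        ≡⟨ ∑-pairs (λ u v → 𝟙 (u ~? v)) adjacency-diag vertices ⟩
      ∑ vertices degree ∎
      where
      -- Spreads the degree sum over the edges: each edge receives one unit for every end in `S`.
      weight-pairs : weight S ≡ ∑ (pairs vertices) (λ (u , v) → χ (S u) * 𝟙 (u ~? v) + χ (S v) * 𝟙 (v ~? u))
      weight-pairs = begin
        weight S
          ≡⟨ ∑-cong (λ u → ∑-*ˡ (χ (S u)) (λ v → 𝟙 (u ~? v)) vertices) vertices ⟨
        ∑ vertices (λ u → ∑ vertices (λ v → χ (S u) * 𝟙 (u ~? v)))
          ≡⟨ ∑-pairs (λ u v → χ (S u) * 𝟙 (u ~? v))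
               (λ v → trans (cong (χ (S v) *_) (adjacency-diag v)) (*-zeroʳ (χ (S v)))) vertices ⟨
        ∑ (pairs vertices) (λ (u , v) → χ (S u) * 𝟙 (u ~? v) + χ (S v) * 𝟙 (v ~? u)) ∎

  rank : Vertex → ℕ
  rank v = toℕ (index (complete v))

  rank-injective : ∀ {u v} → rank u ≡ rank v → u ≡ v
  rank-injective {u} {v} =
    Membership.index-injective (setoid Vertex) (complete u) (complete v) ∘ Finₚ.toℕ-injective

  -- The least elements of the labels form a Sidon set, and the least element
  -- of a sumset is the sum of the least elements.
  label : (Vertex → Bool) → Vertex → FinSet
  label S v = 2 ^ rank v ∷ (if S v then suc (2 ^ rank v) ∷ [] else [])

  label-least : ∀ S v → Least (label S v) (2 ^ rank v)
  label-least S v = here refl , least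
    where
    least : ∀ {x} → x ∈ label S v → 2 ^ rank v ≤ x
    least (here refl) = ≤-refl
    least (there x∈) with S v | x∈
    ... | true | here refl = n≤1+n _

  label-multiIndexed : ∀ S v → multiIndexed (label S) v ≡ S v
  label-multiIndexed S v with S v
  ... | true  = cong (λ k → not (does (k ≟ 1))) (card-pair (<⇒≢ (n<1+n (2 ^ rank v))))
  ... | false = refl

  label-isIASI : ∀ S → IsIASI G (label S)
  label-isIASI S = record
    { nonEmpty      = λ v ()
    ; injective     = λ {u} {v} eq → rank-injective (2^-injective (least-unique eq (label-least S u) (label-least S v)))
    ; edgeInjective = λ {u} {v} {u′} {v′} u~v u′~v′ eq →
        same (2^-sidon (~⇒≢ G u~v ∘ rank-injective) (~⇒≢ G u′~v′ ∘ rank-injective)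
          (least-unique eq (least-⊕ (label-least S u) (label-least S v))
                           (least-⊕ (label-least S u′) (label-least S v′))))
    }
    where
    same : ∀ {u v u′ v′} → (rank u ≡ rank u′ × rank v ≡ rank v′) ⊎ (rank u ≡ rank v′ × rank v ≡ rank u′) →
           SameEdge G u v u′ v′
    same (inj₁ (p , q)) = inj₁ (rank-injective p , rank-injective q)
    same (inj₂ (p , q)) = inj₂ (rank-injective p , rank-injective q)

  -- Independence rules out two-element labels at both ends of an edge. In the other cases the
  -- sumset computes to one integer or to two consecutive ones.
  label-isWIASI : ∀ {S} → Independent S → IsWIASI G (label S)
  label-isWIASI {S} ind = record { isIASI = label-isIASI S ; weak = weak }
    where
    weak : ∀ {u v} → u ~ v → card (label S u ⊕ label S v) ≡ card (label S u) ⊔ card (label S v)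
    weak {u} {v} u~v with S u | S v | ind u~v
    ... | true  | true  | ind = contradiction refl (ind refl)
    ... | false | false | _   = refl
    ... | true  | false | _   =
      trans (card-pair (<⇒≢ (n<1+n (2 ^ rank u + 2 ^ rank v))))
            (cong (_⊔ 1) (sym (card-pair (<⇒≢ (n<1+n (2 ^ rank u))))))
    ... | false | true  | _   =
      trans (card-pair (<⇒≢ (+-monoʳ-< (2 ^ rank u) (n<1+n (2 ^ rank v)))))
            (cong (1 ⊔_) (sym (card-pair (<⇒≢ (n<1+n (2 ^ rank v))))))

  weight-cong : ∀ {S S′} → (∀ v → S v ≡ S′ v) → weight S ≡ weight S′
  weight-cong eq = ∑-cong (λ v → cong (λ b → χ b * degree v) (eq v)) vertices

  -- By `mono-count` the number of mono-indexed edges and the weight have a constant sum, so the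
  -- greatest weight yields the least count. The identity is doubled and additive to avoid halving
  -- and truncated subtraction.
  sparingNumber : ∀ {S} → Independent S → (∀ S′ → Independent S′ → weight S′ ≤ weight S) →
                  ∃[ φ ] IsSparingNumber G φ × 2 * φ + 2 * weight S ≡ ∑ vertices degree
  sparingNumber {S} ind maximal =
    φ , ((label S , wiasi , refl) , minimal) , count
    where
    wiasi = label-isWIASI ind
    φ = length (monoIndexedEdges G (label S))

    count : 2 * φ + 2 * weight S ≡ ∑ vertices degree
    -- The multi-indexed vertices of `label S` agree with `S` only pointwise.
    count = trans (cong (λ w → 2 * φ + 2 * w) (weight-cong (sym ∘ label-multiIndexed S))) (mono-count wiasi)

    minimal : ∀ f → IsWIASI G f → φ ≤ length (monoIndexedEdges G f)
    minimal f wiasi′ = *-cancelˡ-≤ 2 (+-cancelʳ-≤ (2 * weight S) _ _ (begin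
      2 * φ + 2 * weight S
        ≡⟨ trans count (sym (mono-count wiasi′)) ⟩
      2 * length (monoIndexedEdges G f) + 2 * weight (multiIndexed f)
        ≤⟨ +-monoʳ-≤ (2 * length (monoIndexedEdges G f))
             (*-monoʳ-≤ 2 (maximal (multiIndexed f) (multiIndexed-independent wiasi′))) ⟩
      2 * length (monoIndexedEdges G f) + 2 * weight S ∎))
      where open ≤-Reasoning

-- Finite sums over Fin n

∑-allFin : ∀ {n} (f : Fin n → ℕ) → ∑ (allFin n) f ≡ ∑ᶠ f
∑-allFin = ∑-tabulate id
  where
  ∑-tabulate : ∀ {n} {A : Set} (g : Fin n → A) (f : A → ℕ) → ∑ (tabulate g) f ≡ ∑ᶠ (f ∘ g)
  ∑-tabulate {zero}  g f = refl
  ∑-tabulate {suc n} g f = cong (f (g Fin.zero) +_) (∑-tabulate (g ∘ Fin.suc) f)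

∑ᶠ-const : ∀ n c → ∑ᶠ {n} (λ _ → c) ≡ n * c
∑ᶠ-const zero    c = refl
∑ᶠ-const (suc n) c = cong (c +_) (∑ᶠ-const n c)

∑ᶠ≤n : ∀ {n} {f : Fin n → ℕ} → (∀ i → f i ≤ 1) → ∑ᶠ f ≤ n
∑ᶠ≤n {zero}  f≤1 = z≤n
∑ᶠ≤n {suc n} f≤1 = +-mono-≤ (f≤1 Fin.zero) (∑ᶠ≤n (f≤1 ∘ Fin.suc))

∑ᶠ-≟ : ∀ {n} (i : Fin n) → ∑ᶠ (λ j → 𝟙 (i Finₚ.≟ j)) ≡ 1
∑ᶠ-≟ {suc n} Fin.zero    = cong suc (trans (∑ᶠ-const n 0) (*-zeroʳ n))
∑ᶠ-≟ {suc n} (Fin.suc i) = ∑ᶠ-≟ i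

module _ {n} {P : Fin n → Set} (P? : ∀ j → Dec (P j)) where

  count-all : (∀ j → P j) → ∑ᶠ (λ j → 𝟙 (P? j)) ≡ n
  count-all p = trans (sum-cong-≗ (λ j → cong χ (dec-true (P? j) (p j)))) (trans (∑ᶠ-const n 1) (*-identityʳ n))

  count-≢ : ∀ i → (∀ j → P j ⇔ i ≢ j) → suc (∑ᶠ (λ j → 𝟙 (P? j))) ≡ n
  count-≢ i P⇔≢ = begin
    suc (∑ᶠ (λ j → 𝟙 (P? j)))
      ≡⟨ cong (_+ ∑ᶠ (λ j → 𝟙 (P? j))) (∑ᶠ-≟ i) ⟨
    ∑ᶠ (λ j → 𝟙 (i Finₚ.≟ j)) + ∑ᶠ (λ j → 𝟙 (P? j))
      ≡⟨ ∑-distrib-+ (λ j → 𝟙 (i Finₚ.≟ j)) (λ j → 𝟙 (P? j)) ⟨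
    ∑ᶠ (λ j → 𝟙 (i Finₚ.≟ j) + 𝟙 (P? j))
      ≡⟨ sum-cong-≗ complement ⟩
    ∑ᶠ {n} (λ _ → 1)
      ≡⟨ trans (∑ᶠ-const n 1) (*-identityʳ n) ⟩
    n ∎
    where
    open ≡-Reasoning
    complement : ∀ j → 𝟙 (i Finₚ.≟ j) + 𝟙 (P? j) ≡ 1
    complement j with i Finₚ.≟ j
    ... | yes i≡j = cong (suc ∘ χ) (dec-false (P? j) λ p → Equivalence.to (P⇔≢ j) p i≡j)
    ... | no  i≢j = cong χ (dec-true (P? j) (Equivalence.from (P⇔≢ j) i≢j))

  count-two : ∀ {a b} → a ≢ b → (∀ j → P j ⇔ (a ≡ j ⊎ b ≡ j)) → ∑ᶠ (λ j → 𝟙 (P? j)) ≡ 2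
  count-two {a} {b} a≢b P⇔ = begin
    ∑ᶠ (λ j → 𝟙 (P? j))
      ≡⟨ sum-cong-≗ split ⟩
    ∑ᶠ (λ j → 𝟙 (a Finₚ.≟ j) + 𝟙 (b Finₚ.≟ j))
      ≡⟨ ∑-distrib-+ (λ j → 𝟙 (a Finₚ.≟ j)) (λ j → 𝟙 (b Finₚ.≟ j)) ⟩
    ∑ᶠ (λ j → 𝟙 (a Finₚ.≟ j)) + ∑ᶠ (λ j → 𝟙 (b Finₚ.≟ j))
      ≡⟨ cong₂ _+_ (∑ᶠ-≟ a) (∑ᶠ-≟ b) ⟩
    2 ∎
    where
    open ≡-Reasoning
    split : ∀ j → 𝟙 (P? j) ≡ 𝟙 (a Finₚ.≟ j) + 𝟙 (b Finₚ.≟ j)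
    split j with a Finₚ.≟ j | b Finₚ.≟ j
    ... | yes a≡j | yes b≡j = contradiction (trans a≡j (sym b≡j)) a≢b
    ... | yes a≡j | no  _   = cong χ (dec-true (P? j) (Equivalence.from (P⇔ j) (inj₁ a≡j)))
    ... | no  _   | yes b≡j = cong χ (dec-true (P? j) (Equivalence.from (P⇔ j) (inj₂ b≡j)))
    ... | no  a≢j | no  b≢j = cong χ (dec-false (P? j) ([ a≢j , b≢j ]′ ∘ Equivalence.to (P⇔ j)))

-- The cyclic successor

-- The inverse of `next`, defined by structural recursion so that the modular arithmetic is confined
-- to two cases: the last index, and the indices of the form `inject₁ j`.
prev : ∀ {n} → Fin n → Fin n
prev {suc n} Fin.zero    = fromℕ n
prev {suc n} (Fin.suc i) = inject₁ i

next-fromℕ : ∀ n → next (fromℕ n) ≡ Fin.zero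
next-fromℕ n = Finₚ.toℕ-injective (begin
  toℕ (next (fromℕ n))         ≡⟨ Finₚ.toℕ-fromℕ< (m%n<n (suc (toℕ (fromℕ n))) (suc n)) ⟩
  suc (toℕ (fromℕ n)) % suc n  ≡⟨ cong (λ k → suc k % suc n) (Finₚ.toℕ-fromℕ n) ⟩
  suc n % suc n                ≡⟨ n%n≡0 (suc n) ⟩
  0                            ∎)
  where open ≡-Reasoning

next-inject₁ : ∀ {n} (i : Fin n) → next (inject₁ i) ≡ Fin.suc i
next-inject₁ {n} i = Finₚ.toℕ-injective (begin
  toℕ (next (inject₁ i))         ≡⟨ Finₚ.toℕ-fromℕ< (m%n<n (suc (toℕ (inject₁ i))) (suc n)) ⟩
  suc (toℕ (inject₁ i)) % suc n  ≡⟨ cong (λ k → suc k % suc n) (Finₚ.toℕ-inject₁ i) ⟩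
  suc (toℕ i) % suc n            ≡⟨ m<n⇒m%n≡m (s≤s (Finₚ.toℕ<n i)) ⟩
  suc (toℕ i)                    ∎)
  where open ≡-Reasoning

next-prev : ∀ {n} (i : Fin n) → next (prev i) ≡ i
next-prev {suc n} Fin.zero    = next-fromℕ n
next-prev {suc n} (Fin.suc i) = next-inject₁ i

prev-next : ∀ {n} (i : Fin n) → prev (next i) ≡ i
prev-next {suc n} i with view i
... | ‵fromℕ     = cong prev (next-fromℕ n)
... | ‵inject₁ j = cong prev (next-inject₁ j)

next-injective : ∀ {n} {i j : Fin n} → next i ≡ next j → i ≡ j
next-injective {i = i} {j} eq = trans (sym (prev-next i)) (trans (cong prev eq) (prev-next j))

-- Rotation is a permutation. This allows inequalities about consecutive indices to be summed around
-- the cycle.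
∑ᶠ-next : ∀ {n} (f : Fin n → ℕ) → ∑ᶠ (f ∘ next) ≡ ∑ᶠ f
∑ᶠ-next f = sym (sum-permute f (permutation next prev next-prev prev-next))

toℕ-next : ∀ {n} (i : Fin n) →
           (toℕ (next i) ≡ 0 × suc (toℕ i) ≡ n) ⊎ toℕ (next i) ≡ suc (toℕ i)
toℕ-next {suc n} i with view i
... | ‵fromℕ     = inj₁ (cong toℕ (next-fromℕ n) , cong suc (Finₚ.toℕ-fromℕ n))
... | ‵inject₁ j = inj₂ (trans (cong toℕ (next-inject₁ j)) (cong suc (sym (Finₚ.toℕ-inject₁ j))))

next≢ : ∀ {n} → 3 ≤ n → (i : Fin n) → next i ≢ i
next≢ 3≤n i eq with toℕ-next i | cong toℕ eq
... | inj₁ (p , q) | e rewrite sym e | p | sym q with s≤s () ← 3≤n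
... | inj₂ p       | e = 1+n≢n (trans (sym p) e)

-- A wrap-around in either step forces n ≤ 2; without one the value grows by 2. It ensures that the
-- two middle vertices next to a given one are distinct.
next-next≢ : ∀ {n} → 3 ≤ n → (i : Fin n) → next (next i) ≢ i
next-next≢ 3≤n i eq with toℕ-next i | toℕ-next (next i) | cong toℕ eq
... | inj₁ (p , q)  | inj₁ (p′ , q′) | e rewrite p | sym q′ with s≤s () ← 3≤n
... | inj₁ (p , q)  | inj₂ p′        | e rewrite p | p′ | sym e | sym q with s≤s (s≤s ()) ← 3≤n
... | inj₂ p        | inj₁ (p′ , q′) | e rewrite p′ | sym e | p | sym q′ with s≤s (s≤s ()) ← 3≤n
... | inj₂ p        | inj₂ p′        | e = m≢1+n+m (toℕ i) {1} (trans (sym e) (trans p′ (cong suc p)))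

-- Powers of graphs

module _ (G : Graph) where
  open Graph G

  -- Descent from an arbitrary walk to a shortest one, with `r` as the decreasing bound: a walk of
  -- length d < k ≤ r has d ≤ r - 1. Adjacency in a power then needs only some walk of length at
  -- most r, not the exact distance.
  shortest : ∀ {u v} r k → k ≤ r → Walk G k u v → ∃[ d ] d ≤ r × IsDistance G u v d
  shortest {u} {v} r k k≤r p with anyUpTo? (λ d → walk? G d u v) k
  ... | no shorter∄ = k , k≤r , p , λ d q → ≮⇒≥ λ d<k → shorter∄ (d , d<k , q)
  ... | yes (d , d<k , q) with s≤s {n = r} k≤r ← <-≤-trans d<k k≤r =
    let (e , e≤r , dist) = shortest r d k≤r q in e , m≤n⇒m≤1+n e≤r , dist

  walk⇒powerAdj : ∀ {r k u v} → u ≢ v → k ≤ r → Walk G k u v → PowerAdj G r u v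
  walk⇒powerAdj {r} {k} u≢v k≤r p = u≢v , shortest r k k≤r p

-- Powers of the gear graph

∑-gear : ∀ n (f : GearVertex n → ℕ) →
         ∑ (gearVertices n) f ≡ f hub + (∑ᶠ (f ∘ rim) + ∑ᶠ (f ∘ mid))
∑-gear n f = cong (f hub +_) (trans (∑-++ f (map rim (allFin n)) (map mid (allFin n)))
  (cong₂ _+_ (trans (∑-map rim f (allFin n)) (∑-allFin (f ∘ rim)))
             (trans (∑-map mid f (allFin n)) (∑-allFin (f ∘ mid)))))

-- The contribution of a vertex set containing h hubs, R rim and M middle
-- vertices to the degree sum.
load : (n dR dM h R M : ℕ) → ℕ
load n dR dM h R M = h * (n + n) + (R * dR + M * dM)

module GearPower (n : ℕ) (n≥3 : 3 ≤ n) where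

  G : Graph
  G = gear n n≥3

  hub~rim : ∀ {r} → 1 ≤ r → ∀ i → PowerAdj G r hub (rim i)
  hub~rim 1≤r i = walk⇒powerAdj G (λ ()) 1≤r (cons tt nil)

  hub~mid : ∀ {r} → 2 ≤ r → ∀ i → PowerAdj G r hub (mid i)
  hub~mid 2≤r i = walk⇒powerAdj G (λ ()) 2≤r (cons {w = rim i} tt (cons (inj₁ refl) nil))

  rim~rim : ∀ {r} → 2 ≤ r → ∀ {i j} → i ≢ j → PowerAdj G r (rim i) (rim j)
  rim~rim 2≤r i≢j = walk⇒powerAdj G (i≢j ∘ rim-injective) 2≤r (cons {w = hub} tt (cons tt nil))

  rim~mid : ∀ {r} → 1 ≤ r → ∀ {i j} → i ≡ j ⊎ i ≡ next j → PowerAdj G r (rim i) (mid j)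
  rim~mid 1≤r e = walk⇒powerAdj G (λ ()) 1≤r (cons e nil)

  rim~mid₃ : ∀ {r} → 3 ≤ r → ∀ i j → PowerAdj G r (rim i) (mid j)
  rim~mid₃ 3≤r i j =
    walk⇒powerAdj G (λ ()) 3≤r (cons {w = hub} tt (cons {w = rim j} tt (cons (inj₁ refl) nil)))

  mid~next : ∀ {r} → 2 ≤ r → ∀ i → PowerAdj G r (mid i) (mid (next i))
  mid~next 2≤r i =
    walk⇒powerAdj G (next≢ n≥3 i ∘ sym ∘ mid-injective) 2≤r
      (cons {w = rim (next i)} (inj₂ refl) (cons (inj₁ refl) nil))

  mid~mid₄ : ∀ {r} → 4 ≤ r → ∀ {i j} → i ≢ j → PowerAdj G r (mid i) (mid j)
  mid~mid₄ 4≤r {i} {j} i≢j =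
    walk⇒powerAdj G (i≢j ∘ mid-injective) 4≤r
      (cons {w = rim i} (inj₁ refl) (cons {w = hub} tt (cons {w = rim j} tt (cons (inj₁ refl) nil))))

  -- The gear graph is bipartite with the rim vertices on one side, so walks from a rim to a middle
  -- vertex have odd length; within length 2 only edges remain.
  rim~mid⁻ : ∀ {i j} → PowerAdj G 2 (rim i) (mid j) → i ≡ j ⊎ i ≡ next j
  rim~mid⁻ (_ , 1 , _ , cons e nil , _) = e
  rim~mid⁻ (_ , 2 , _ , cons {w = hub} _ (cons () nil) , _)
  rim~mid⁻ (_ , 2 , _ , cons {w = mid _} _ (cons () nil) , _)
  rim~mid⁻ (_ , suc (suc (suc _)) , s≤s (s≤s ()) , _)

  -- By bipartiteness the distance can only be 2, through a shared rim vertex. Hence adjacency among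
  -- middle vertices is the same n-cycle in the square and in the cube.
  mid~mid⁻ : ∀ {r i j} → r ≤ 3 → PowerAdj G r (mid i) (mid j) → next i ≡ j ⊎ next j ≡ i
  mid~mid⁻ _ (i≢j , 0 , _ , nil , _) = contradiction refl i≢j
  mid~mid⁻ _ (_ , 1 , _ , cons () nil , _)
  mid~mid⁻ _ (i≢j , 2 , _ , cons {w = rim k} e (cons e′ nil) , _) with e | e′
  ... | inj₁ refl | inj₁ refl = contradiction refl i≢j
  ... | inj₁ refl | inj₂ eq   = inj₂ (sym eq)
  ... | inj₂ refl | inj₁ eq   = inj₁ eq
  ... | inj₂ refl | inj₂ eq   = contradiction (cong mid (next-injective eq)) i≢j
  mid~mid⁻ _ (_ , 3 , _ , cons {w = rim _} _ (cons {w = hub} _ (cons () nil)) , _)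
  mid~mid⁻ _ (_ , 3 , _ , cons {w = rim _} _ (cons {w = mid _} _ (cons () nil)) , _)
  mid~mid⁻ r≤3 (_ , suc (suc (suc (suc d))) , d≤r , _) with s≤s (s≤s (s≤s ())) ← ≤-trans d≤r r≤3

  rims : (GearVertex n → Bool) → ℕ
  rims S = ∑ᶠ (χ ∘ S ∘ rim)

  mids : (GearVertex n → Bool) → ℕ
  mids S = ∑ᶠ (χ ∘ S ∘ mid)

  ∑-hub-rims : ∀ S → ∑ (hub ∷ map rim (allFin n)) (χ ∘ S) ≡ χ (S hub) + rims S
  ∑-hub-rims S = cong (χ (S hub) +_) (trans (∑-map rim (χ ∘ S) (allFin n)) (∑-allFin (χ ∘ S ∘ rim)))

  ∑-consecutive-mids : ∀ S → ∑ᶠ (λ i → χ (S (mid i)) + χ (S (mid (next i)))) ≡ 2 * mids S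
  ∑-consecutive-mids S = trans (∑-distrib-+ (χ ∘ S ∘ mid) (χ ∘ S ∘ mid ∘ next))
    (cong (mids S +_) (trans (∑ᶠ-next (χ ∘ S ∘ mid)) (sym (+-identityʳ (mids S)))))

  module _ (r : ℕ) .{{_ : NonZero r}} (2≤r : 2 ≤ r) where

    H : Graph
    H = G ^ᴳ r

    open Graph H using (_~?_; ~-sym; ~-irrefl)

    1≤r : 1 ≤ r
    1≤r = ≤-trans (n≤1+n 1) 2≤r

    hub-clique : AllPairs (PowerAdj G r) (hub ∷ map rim (allFin n))
    hub-clique = Allₚ.map⁺ (Allₚ.tabulate⁺ (hub~rim 1≤r)) ∷ AllPairsₚ.map⁺ (AllPairsₚ.tabulate⁺ (rim~rim 2≤r))

    hub+rims≤1 : ∀ S → Independent H S → χ (S hub) + rims S ≤ 1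
    hub+rims≤1 S ind = subst (_≤ 1) (∑-hub-rims S) (clique-∑≤1 H {S} ind hub-clique)

    -- Sums the clique inequality for {hub, wᵢ, wᵢ₊₁, vᵢ₊₁} over all i.
    hub+mids+rims≤n : ∀ S → Independent H S → n * χ (S hub) + (2 * mids S + rims S) ≤ n
    hub+mids+rims≤n S ind = begin
      n * χ (S hub) + (2 * mids S + rims S)
        ≡⟨ cong₂ _+_ (∑ᶠ-const n (χ (S hub))) (cong₂ _+_ (∑-consecutive-mids S) (∑ᶠ-next (χ ∘ S ∘ rim))) ⟨
      ∑ᶠ {n} (λ _ → χ (S hub)) +
      (∑ᶠ (λ i → χ (S (mid i)) + χ (S (mid (next i)))) + ∑ᶠ (λ i → χ (S (rim (next i)))))
        ≡⟨ cong (∑ᶠ {n} (λ _ → χ (S hub)) +_) (∑-distrib-+ {n} _ _) ⟨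
      ∑ᶠ {n} (λ _ → χ (S hub)) +
      ∑ᶠ (λ i → χ (S (mid i)) + χ (S (mid (next i))) + χ (S (rim (next i))))
        ≡⟨ ∑-distrib-+ {n} _ _ ⟨
      ∑ᶠ (λ i → χ (S hub) + (χ (S (mid i)) + χ (S (mid (next i))) + χ (S (rim (next i)))))
        ≤⟨ ∑ᶠ≤n (λ i → subst (_≤ 1) (reassoc (χ (S hub)) (χ (S (mid i))) _ _) (clique-∑≤1 H {S} ind (clique i))) ⟩
      n ∎
      where
      open ≤-Reasoning
      reassoc : ∀ a b c d → a + (b + (c + (d + 0))) ≡ a + (b + c + d)
      reassoc a b c d = cong (a +_) (trans (cong (λ x → b + (c + x)) (+-identityʳ d)) (sym (+-assoc b c d)))

      clique : ∀ i → AllPairs (PowerAdj G r) (hub ∷ mid i ∷ mid (next i) ∷ rim (next i) ∷ [])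
      clique i =
        (hub~mid 2≤r i ∷ hub~mid 2≤r (next i) ∷ hub~rim 1≤r (next i) ∷ []) ∷
        (mid~next 2≤r i ∷ ~-sym (rim~mid 1≤r (inj₂ refl)) ∷ []) ∷
        (~-sym (rim~mid 1≤r (inj₁ refl)) ∷ []) ∷ [] ∷ []

    degree-hub : degree H hub ≡ n + n
    degree-hub = trans (∑-gear n (λ v → 𝟙 (hub ~? v))) (cong₂ _+_ (cong χ (dec-false (hub ~? hub) (~-irrefl hub)))
      (cong₂ _+_ (count-all (λ i → hub ~? rim i) (hub~rim 1≤r)) (count-all (λ i → hub ~? mid i) (hub~mid 2≤r))))

    -- The hub makes up for `rim i` not being its own neighbour, so hub and rim together contribute
    -- exactly n.
    degree-rim : ∀ {d} i → ∑ᶠ (λ j → 𝟙 (rim i ~? mid j)) ≡ d → degree H (rim i) ≡ n + d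
    degree-rim i eq = trans (∑-gear n (λ v → 𝟙 (rim i ~? v)))
      (trans (cong (_+ (∑ᶠ (λ j → 𝟙 (rim i ~? rim j)) + ∑ᶠ (λ j → 𝟙 (rim i ~? mid j))))
                   (cong χ (dec-true (rim i ~? hub) (~-sym (hub~rim 1≤r i)))))
             (cong₂ _+_ (count-≢ (λ j → rim i ~? rim j) i
                          (λ j → mk⇔ (λ e → proj₁ e ∘ cong rim) (rim~rim 2≤r)))
                        eq))

    degree-mid : ∀ {d e} i → ∑ᶠ (λ j → 𝟙 (mid i ~? rim j)) ≡ d → ∑ᶠ (λ j → 𝟙 (mid i ~? mid j)) ≡ e →
                 degree H (mid i) ≡ suc (d + e)
    degree-mid i eq eq′ = trans (∑-gear n (λ v → 𝟙 (mid i ~? v)))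
      (cong₂ _+_ (cong χ (dec-true (mid i ~? hub) (~-sym (hub~mid 2≤r i)))) (cong₂ _+_ eq eq′))

    module _ {dR dM : ℕ} (degR : ∀ i → degree H (rim i) ≡ dR) (degM : ∀ i → degree H (mid i) ≡ dM) where

      -- Reduces the search for the heaviest independent set to an inequality in three numbers.
      weight-gear : ∀ S → weight H S ≡ load n dR dM (χ (S hub)) (rims S) (mids S)
      weight-gear S = trans (∑-gear n (λ v → χ (S v) * degree H v)) (cong₂ _+_ (cong (χ (S hub) *_) degree-hub)
        (cong₂ _+_ (scale rim degR) (scale mid degM)))
        where
        scale : ∀ {d} (v : Fin n → GearVertex n) → (∀ i → degree H (v i) ≡ d) →
                ∑ᶠ (λ i → χ (S (v i)) * degree H (v i)) ≡ ∑ᶠ (χ ∘ S ∘ v) * d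
        scale {d} v deg = trans (sum-cong-≗ (λ i → cong (χ (S (v i)) *_) (deg i)))
                                (sym (*-distribʳ-sum d (χ ∘ S ∘ v)))

      ∑-degree : ∑ (gearVertices n) (degree H) ≡ load n dR dM 1 n n
      ∑-degree = trans (∑-gear n (degree H)) (cong₂ _+_ (trans degree-hub (sym (*-identityˡ (n + n))))
        (cong₂ _+_ (trans (sum-cong-≗ degR) (∑ᶠ-const n dR)) (trans (sum-cong-≗ degM) (∑ᶠ-const n dM))))

      gear-sparing : ∀ {S R M} → rims S ≡ R → mids S ≡ M → Independent H S →
        (∀ S′ → Independent H S′ →
           load n dR dM (χ (S′ hub)) (rims S′) (mids S′) ≤ load n dR dM (χ (S hub)) R M) →
        ∃[ φ ] IsSparingNumber H φ × 2 * φ + 2 * load n dR dM (χ (S hub)) R M ≡ load n dR dM 1 n n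
      gear-sparing {S} refl refl ind maximal =
        let (φ , sparing , eq) = sparingNumber H {S} ind λ S′ ind′ →
              subst₂ _≤_ (sym (weight-gear S′)) (sym (weight-gear S)) (maximal S′ ind′)
        in φ , sparing , trans (cong (λ w → 2 * φ + 2 * w) (sym (weight-gear S))) (trans eq ∑-degree)

  two-mids : ∀ (i j : Fin n) → (i ≡ j ⊎ i ≡ next j) ⇔ (i ≡ j ⊎ prev i ≡ j)
  two-mids i j = mk⇔ [ inj₁ , (λ eq → inj₂ (trans (cong prev eq) (prev-next j))) ]′
                     [ inj₁ , (λ eq → inj₂ (trans (sym (next-prev i)) (cong next eq))) ]′

  prev≢ : ∀ (i : Fin n) → i ≢ prev i
  prev≢ i eq = next≢ n≥3 i (trans (cong next eq) (next-prev i))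

  next≢prev : ∀ (i : Fin n) → next i ≢ prev i
  next≢prev i eq = next-next≢ n≥3 i (trans (cong next eq) (next-prev i))

  count-mids : ∀ r → .{{_ : NonZero r}} → 2 ≤ r → r ≤ 3 → ∀ i →
               ∑ᶠ (λ j → 𝟙 (powerAdj? G r (mid i) (mid j))) ≡ 2
  count-mids r 2≤r r≤3 i = count-two (λ j → powerAdj? G r (mid i) (mid j)) (next≢prev i)
    λ j → mk⇔ ([ inj₁ , (λ eq → inj₂ (trans (cong prev (sym eq)) (prev-next j))) ]′ ∘ mid~mid⁻ r≤3)
              (from j)
    where
    from : ∀ j → next i ≡ j ⊎ prev i ≡ j → PowerAdj G r (mid i) (mid j)
    from j (inj₁ refl) = mid~next 2≤r i
    from j (inj₂ refl) = Graph.~-sym (G ^ᴳ r) (subst (PowerAdj G r (mid j) ∘ mid) (next-prev i) (mid~next 2≤r j))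

-- Parity

-- Boolean-valued, so that it can serve as the characteristic function of a vertex set.
odd : ℕ → Bool
odd zero    = false
odd (suc n) = not (odd n)

odd-suc : ∀ n → odd n ≡ true → odd (suc n) ≢ true
odd-suc n p q rewrite p with () ← q

2∣⇒¬odd : ∀ {n} → 2 ∣ n → odd n ≡ false
2∣⇒¬odd (divides zero    refl) = refl
2∣⇒¬odd (divides (suc k) refl) = cong (not ∘ not) (2∣⇒¬odd (divides k refl))

¬odd⇒2∣ : ∀ {n} → odd n ≡ false → 2 ∣ n
¬odd⇒2∣ {zero}        _ = divides 0 refl
¬odd⇒2∣ {suc (suc n)} p = ∣m∣n⇒∣m+n ∣-refl (¬odd⇒2∣ {n} (trans (sym (not-involutive (odd n))) p))

2∤⇒odd : ∀ {n} → 2 ∤ n → odd n ≡ true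
2∤⇒odd 2∤n = ¬-not (2∤n ∘ ¬odd⇒2∣)

-- Determines the count as ⌊n / 2⌋ without division. The induction goes by two because parity
-- returns after two steps.
∑ᶠ-odd : ∀ n → 2 * ∑ᶠ {n} (χ ∘ odd ∘ toℕ) + χ (odd n) ≡ n
∑ᶠ-odd zero          = refl
∑ᶠ-odd (suc zero)    = refl
∑ᶠ-odd (suc (suc n))
  rewrite sum-cong-≗ {n} (λ i → cong χ (not-involutive (odd (toℕ i)))) | not-involutive (odd n) =
  trans (shift (∑ᶠ {n} (χ ∘ odd ∘ toℕ)) (χ (odd n))) (cong (suc ∘ suc) (∑ᶠ-odd n))
  where
  shift : ∀ s c → 2 * suc s + c ≡ suc (suc (2 * s + c))
  shift = solve-∀

-- The shift of `odd` by one; among the indices below n it selects ⌊(n - 1) / 2⌋.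
positiveEven : ℕ → Bool
positiveEven zero    = false
positiveEven (suc n) = odd n

∑ᶠ-positiveEven : ∀ {n} → 1 ≤ n → suc (2 * ∑ᶠ {n} (χ ∘ positiveEven ∘ toℕ) + χ (not (odd n))) ≡ n
∑ᶠ-positiveEven {suc n} _ rewrite not-involutive (odd n) = cong suc (∑ᶠ-odd n)

module _ {n : ℕ} (i : Fin n) where

  -- Consecutive integers differ in parity, and the wrap-around lands on 0, which is not selected;
  -- so the selection is independent on the cycle for either parity of n.
  odd-next : odd (toℕ i) ≡ true → odd (toℕ (next i)) ≢ true
  odd-next p q with toℕ-next i
  ... | inj₁ (eq , _) rewrite eq with () ← q
  ... | inj₂ eq       rewrite eq = odd-suc (toℕ i) p q

  positiveEven-next : positiveEven (toℕ i) ≡ true → positiveEven (toℕ (next i)) ≢ true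
  positiveEven-next p q with toℕ i | toℕ-next i
  ... | suc k | inj₁ (eq , _) rewrite eq with () ← q
  ... | suc k | inj₂ eq       rewrite eq = odd-suc k p q

-- Extremal inequalities

open ≤-Reasoning

even-gap : ∀ {x n} → 2 ∣ x → 2 ∣ n → x < n → 2 + x ≤ n
even-gap (divides a refl) (divides b refl) x<n = *-monoˡ-≤ 2 (*-cancelʳ-< 2 a b x<n)

-- If R = 1, then `n * h + 2 * M` is even and less than the even number n, so the gap is at least 2
-- and the coefficient of R can be doubled.
tighten-even : ∀ {n} h {R} M → 2 ∣ n → R ≤ 1 → n * h + (2 * M + R) ≤ n → n * h + (2 * M + 2 * R) ≤ n
tighten-even h M 2∣n z≤n le = le
tighten-even {n} h M 2∣n (s≤s z≤n) le = begin
  n * h + (2 * M + 2)  ≡⟨ shift (n * h) (2 * M) ⟩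
  2 + (n * h + 2 * M)  ≤⟨ even-gap (∣m∣n⇒∣m+n (∣m⇒∣m*n h 2∣n) (m∣m*n M)) 2∣n (subst (_≤ n) (shift₁ (n * h) (2 * M)) le) ⟩
  n                    ∎
  where
  shift : ∀ a b → a + (b + 2) ≡ 2 + (a + b)
  shift = solve-∀
  shift₁ : ∀ a b → a + (b + 1) ≡ suc (a + b)
  shift₁ = solve-∀

-- The odd wheel inequality: with t = 0, `2 * M` cannot equal the odd n; with t = 1, both sides
-- merely drop by one.
tighten-odd : ∀ {n t} M → 2 ∤ n → t ≤ 1 → n * t + 2 * M ≤ n → pred n * t + 2 * M ≤ pred n
tighten-odd {zero}  M 2∤0 _         _  = contradiction (divides 0 refl) 2∤0
tighten-odd {suc p} M 2∤n (s≤s z≤n) le = ≤-pred le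
tighten-odd {suc p} M 2∤n z≤n       le
  rewrite *-zeroʳ p = ≤-pred (≤∧≢⇒< le λ eq → 2∤n (subst (2 ∣_) eq (m∣m*n M)))

-- The multiplier 5 matches the coefficient of M, and `5 + 2 * q` then matches that of R; the excess
-- at h is the slack. Writing n as `3 + q` keeps all coefficients natural numbers.
load₂-odd-≤ : ∀ q {n} h R M k → n ≡ 3 + q → h + R ≤ 1 → n * h + (2 * M + R) ≤ n → 2 * k + 1 ≡ n →
              load n (n + 2) 5 h R M ≤ load n (n + 2) 5 0 1 k
load₂-odd-≤ q {n} h R M k refl c₁ c₂ eq = *-cancelˡ-≤ 2 (begin
  2 * load n (n + 2) 5 h R M                                       ≤⟨ m≤m+n _ ((8 + 3 * q) * h) ⟩
  2 * load n (n + 2) 5 h R M + (8 + 3 * q) * h                     ≡⟨ combine q h R M ⟩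
  5 * (n * h + (2 * M + R)) + (5 + 2 * q) * (h + R)                ≤⟨ +-mono-≤ (*-monoʳ-≤ 5 c₂) (*-monoʳ-≤ (5 + 2 * q) c₁) ⟩
  5 * n + (5 + 2 * q) * 1                                          ≡⟨ cong (λ m → 5 * m + (5 + 2 * q) * 1) eq ⟨
  5 * (2 * k + 1) + (5 + 2 * q) * 1                                ≡⟨ extremal q k ⟩
  2 * load n (n + 2) 5 0 1 k                                       ∎)
  where
  combine : ∀ q h R M →
    2 * (h * (3 + q + (3 + q)) + (R * (3 + q + 2) + M * 5)) + (8 + 3 * q) * h ≡
    5 * ((3 + q) * h + (2 * M + R)) + (5 + 2 * q) * (h + R)
  combine = solve-∀
  extremal : ∀ q k → 5 * (2 * k + 1) + (5 + 2 * q) * 1 ≡ 2 * (0 + (1 * (3 + q + 2) + k * 5))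
  extremal = solve-∀

-- The doubled coefficient of R lowers the second multiplier to `2 * q`, twice the degree difference
-- between a rim and a middle vertex.
load₂-even-≤ : ∀ q {n} h R M k → n ≡ 3 + q → h + R ≤ 1 → n * h + (2 * M + 2 * R) ≤ n → 2 * k + 2 ≡ n →
               load n (n + 2) 5 h R M ≤ load n (n + 2) 5 0 1 k
load₂-even-≤ q {n} h R M k refl c₁ c₂ eq = *-cancelˡ-≤ 2 (begin
  2 * load n (n + 2) 5 h R M                           ≤⟨ m≤m+n _ ((3 + 3 * q) * h) ⟩
  2 * load n (n + 2) 5 h R M + (3 + 3 * q) * h         ≡⟨ combine q h R M ⟩
  5 * (n * h + (2 * M + 2 * R)) + 2 * q * (h + R)      ≤⟨ +-mono-≤ (*-monoʳ-≤ 5 c₂) (*-monoʳ-≤ (2 * q) c₁) ⟩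
  5 * n + 2 * q * 1                                    ≡⟨ cong (λ m → 5 * m + 2 * q * 1) eq ⟨
  5 * (2 * k + 2) + 2 * q * 1                          ≡⟨ extremal q k ⟩
  2 * load n (n + 2) 5 0 1 k                           ∎)
  where
  combine : ∀ q h R M →
    2 * (h * (3 + q + (3 + q)) + (R * (3 + q + 2) + M * 5)) + (3 + 3 * q) * h ≡
    5 * ((3 + q) * h + (2 * M + 2 * R)) + 2 * q * (h + R)
  combine = solve-∀
  extremal : ∀ q k → 5 * (2 * k + 2) + 2 * q * 1 ≡ 2 * (0 + (1 * (3 + q + 2) + k * 5))
  extremal = solve-∀

-- Hub and rim vertices both have degree 2n, so only `h + R` matters and a single constraint with
-- multiplier `n + 3` suffices.
load₃-even-≤ : ∀ q {n} h R M k → n ≡ 3 + q → n * (h + R) + 2 * M ≤ n → 2 * k ≡ n →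
               load n (n + n) (n + 3) h R M ≤ load n (n + n) (n + 3) 0 0 k
load₃-even-≤ q {n} h R M k refl c eq = *-cancelˡ-≤ 2 (begin
  2 * load n (n + n) (n + 3) h R M                           ≤⟨ m≤m+n _ (n * (2 + q) * (h + R)) ⟩
  2 * load n (n + n) (n + 3) h R M + n * (2 + q) * (h + R)   ≡⟨ combine q h R M ⟩
  (n + 3) * (n * (h + R) + 2 * M)                            ≤⟨ *-monoʳ-≤ (n + 3) c ⟩
  (n + 3) * n                                                ≡⟨ cong ((n + 3) *_) eq ⟨
  (n + 3) * (2 * k)                                          ≡⟨ extremal (n + 3) k ⟩
  2 * load n (n + n) (n + 3) 0 0 k                           ∎)
  where
  combine : ∀ q h R M →
    2 * (h * (3 + q + (3 + q)) + (R * (3 + q + (3 + q)) + M * (3 + q + 3))) + (3 + q) * (2 + q) * (h + R) ≡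
    (3 + q + 3) * ((3 + q) * (h + R) + 2 * M)
  combine = solve-∀
  extremal : ∀ d k → d * (2 * k) ≡ 2 * (k * d)
  extremal = solve-∀

-- The slack coefficient `q * (q + 4)` is (n - 3)(n + 1); it vanishes at n = 3, where the hub is
-- extremal too.
load₃-odd-≤ : ∀ q {n} h R M k → n ≡ 3 + q → pred n * (h + R) + 2 * M ≤ pred n → 2 * k + 1 ≡ n →
              load n (n + n) (n + 3) h R M ≤ load n (n + n) (n + 3) 0 0 k
load₃-odd-≤ q {n} h R M k refl c eq = *-cancelˡ-≤ 2 (begin
  2 * load n (n + n) (n + 3) h R M                           ≤⟨ m≤m+n _ (q * (q + 4) * (h + R)) ⟩
  2 * load n (n + n) (n + 3) h R M + q * (q + 4) * (h + R)   ≡⟨ combine q h R M ⟩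
  (n + 3) * ((2 + q) * (h + R) + 2 * M)                      ≤⟨ *-monoʳ-≤ (n + 3) c ⟩
  (n + 3) * (2 + q)                                          ≡⟨ cong ((n + 3) *_) (suc-injective (trans (+-comm 1 (2 * k)) eq)) ⟨
  (n + 3) * (2 * k)                                          ≡⟨ extremal (n + 3) k ⟩
  2 * load n (n + n) (n + 3) 0 0 k                           ∎)
  where
  combine : ∀ q h R M →
    2 * (h * (3 + q + (3 + q)) + (R * (3 + q + (3 + q)) + M * (3 + q + 3))) + q * (q + 4) * (h + R) ≡
    (3 + q + 3) * ((2 + q) * (h + R) + 2 * M)
  combine = solve-∀
  extremal : ∀ d k → d * (2 * k) ≡ 2 * (k * d)
  extremal = solve-∀

-- Solving the counting identity for the sparing number

isolate-2φ : ∀ φ {x d} t → 2 * φ + x ≡ d → d ≡ t + x → 2 * φ ≡ t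
isolate-2φ φ {x} t eq eq′ = +-cancelʳ-≡ x _ _ (trans eq eq′)

φ₂-even : ∀ {n} k φ → 2 * k + 2 ≡ n →
          2 * φ + 2 * load n (n + 2) 5 0 1 k ≡ load n (n + 2) 5 1 n n → 2 * φ ≡ (n + 1) ^ 2 + 5
φ₂-even {n} k φ refl eq = isolate-2φ φ ((n + 1) ^ 2 + 5) eq (identity k)
  where
  identity : ∀ k → let n = 2 * k + 2 in
    1 * (n + n) + (n * (n + 2) + n * 5) ≡ (n + 1) * ((n + 1) * 1) + 5 + 2 * (0 + (1 * (n + 2) + k * 5))
  identity = solve-∀

φ₂-odd : ∀ {n} k φ → 2 * k + 1 ≡ n →
         2 * φ + 2 * load n (n + 2) 5 0 1 k ≡ load n (n + 2) 5 1 n n → 2 * φ ≡ (n + 1) ^ 2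
φ₂-odd {n} k φ refl eq = isolate-2φ φ ((n + 1) ^ 2) eq (identity k)
  where
  identity : ∀ k → let n = 2 * k + 1 in
    1 * (n + n) + (n * (n + 2) + n * 5) ≡ (n + 1) * ((n + 1) * 1) + 2 * (0 + (1 * (n + 2) + k * 5))
  identity = solve-∀

φ₃-even : ∀ {n} k φ → 2 * k ≡ n →
          2 * φ + 2 * load n (n + n) (n + 3) 0 0 k ≡ load n (n + n) (n + 3) 1 n n → φ ≡ n * (n + 1)
φ₃-even {n} k φ refl eq = *-cancelˡ-≡ _ _ 2 (isolate-2φ φ (2 * (n * (n + 1))) eq (identity k))
  where
  identity : ∀ k → let n = 2 * k in
    1 * (n + n) + (n * (n + n) + n * (n + 3)) ≡ 2 * (n * (n + 1)) + 2 * (k * (n + 3))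
  identity = solve-∀

φ₃-odd : ∀ {n} k φ → 2 * k + 1 ≡ n →
         2 * φ + 2 * load n (n + n) (n + 3) 0 0 k ≡ load n (n + n) (n + 3) 1 n n →
         2 * φ ≡ 2 * n ^ 2 + 3 * n + 3
φ₃-odd {n} k φ refl eq = isolate-2φ φ (2 * n ^ 2 + 3 * n + 3) eq (identity k)
  where
  identity : ∀ k → let n = 2 * k + 1 in
    1 * (n + n) + (n * (n + n) + n * (n + 3)) ≡ 2 * (n * (n * 1)) + 3 * n + 3 + 2 * (k * (n + 3))
  identity = solve-∀

φ₄ : ∀ {n} φ → 3 ≤ n →
     2 * φ + 2 * load n (n + n) (n + n) 1 0 0 ≡ load n (n + n) (n + n) 1 n n → φ ≡ n * (2 * n ∸ 1)
φ₄ {suc m} φ _ eq = *-cancelˡ-≡ _ _ 2 (isolate-2φ φ (2 * (suc m * (2 * suc m ∸ 1))) eq (identity m))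
  where
  identity : ∀ m → let n = suc m in
    -- The term `m + suc (m + 0)` is what `2 * suc m ∸ 1` computes to, free of subtraction.
    1 * (n + n) + (n * (n + n) + n * (n + n)) ≡ 2 * (n * (m + suc (m + 0))) + 2 * (1 * (n + n) + 0)
  identity = solve-∀

module _ (n : ℕ) (n≥3 : 3 ≤ n) where

  open GearPower n n≥3

  private
    n≡3+[n∸3] : n ≡ 3 + (n ∸ 3)
    n≡3+[n∸3] = sym (m+[n∸m]≡n n≥3)

    2≤3 : 2 ≤ 3
    2≤3 = n≤1+n 2

    2≤4 : 2 ≤ 4
    2≤4 = m≤m+n 2 2

  -- Second power: one rim vertex and alternate middle vertices

  module Square where

    1≤n : 1 ≤ n
    1≤n = ≤-trans (s≤s z≤n) n≥3

    v₀ : Fin n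
    v₀ = fromℕ< 1≤n

    toℕ-v₀ : toℕ v₀ ≡ 0
    toℕ-v₀ = Finₚ.toℕ-fromℕ< 1≤n

    -- v₀ together with every second wᵢ among those not adjacent to it.
    S : GearVertex n → Bool
    S hub     = false
    S (rim i) = does (v₀ Finₚ.≟ i)
    S (mid i) = positiveEven (toℕ (next i))

    k : ℕ
    k = ∑ᶠ {n} (χ ∘ positiveEven ∘ toℕ)

    rims-S : rims S ≡ 1
    rims-S = ∑ᶠ-≟ v₀

    mids-S : mids S ≡ k
    mids-S = ∑ᶠ-next {n} (χ ∘ positiveEven ∘ toℕ)

    S-rim : ∀ {i} → S (rim i) ≡ true → i ≡ v₀
    S-rim {i} Si with v₀ Finₚ.≟ i
    ... | yes v₀≡i = sym v₀≡i

    -- The middle vertices next to v₀ have indices 0 and n - 1. Their successors are 1 and 0, and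
    -- `positiveEven` fails at both.
    v₀≁mid : ∀ {j} → v₀ ≡ j ⊎ v₀ ≡ next j → S (mid j) ≢ true
    v₀≁mid {j} (inj₁ v₀≡j) Sj with toℕ-next j
    ... | inj₁ (eq , _) rewrite eq with () ← Sj
    ... | inj₂ eq       rewrite eq | sym v₀≡j | toℕ-v₀ with () ← Sj
    v₀≁mid {j} (inj₂ eq)   Sj rewrite sym eq | toℕ-v₀ with () ← Sj

    rim≁mid : ∀ {i j} → i ≡ j ⊎ i ≡ next j → S (rim i) ≡ true → S (mid j) ≢ true
    rim≁mid {i} {j} e Si = v₀≁mid (subst (λ i → i ≡ j ⊎ i ≡ next j) (S-rim {i} Si) e)

    independent : Independent (G ^ᴳ 2) S
    independent {rim i} {rim j} (u≢v , _) Si Sj = u≢v (cong rim (trans (S-rim {i} Si) (sym (S-rim {j} Sj))))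
    independent {rim i} {mid j} e Si Sj = rim≁mid (rim~mid⁻ e) Si Sj
    independent {mid i} {rim j} e Si Sj = rim≁mid (rim~mid⁻ (Graph.~-sym (G ^ᴳ 2) e)) Sj Si
    independent {mid i} {mid j} e Si Sj with mid~mid⁻ 2≤3 e
    ... | inj₁ refl = positiveEven-next (next i) Si Sj
    ... | inj₂ refl = positiveEven-next (next j) Sj Si

    degree-rim₂ : ∀ i → degree (G ^ᴳ 2) (rim i) ≡ n + 2
    degree-rim₂ i = degree-rim 2 ≤-refl i (count-two (λ j → powerAdj? G 2 (rim i) (mid j)) (prev≢ i) λ j →
      mk⇔ (Equivalence.to (two-mids i j) ∘ rim~mid⁻) (rim~mid (s≤s z≤n) ∘ Equivalence.from (two-mids i j)))

    -- The 5 consists of the hub, two rim vertices and two middle vertices.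
    degree-mid₂ : ∀ i → degree (G ^ᴳ 2) (mid i) ≡ 5
    degree-mid₂ i = degree-mid 2 ≤-refl i
      (count-two (λ j → powerAdj? G 2 (mid i) (rim j)) (next≢ n≥3 i ∘ sym) λ j →
        mk⇔ ([ inj₁ ∘ sym , inj₂ ∘ sym ]′ ∘ rim~mid⁻ ∘ Graph.~-sym (G ^ᴳ 2))
            (Graph.~-sym (G ^ᴳ 2) ∘ rim~mid (s≤s z≤n) ∘ [ inj₁ ∘ sym , inj₂ ∘ sym ]′))
      (count-mids 2 ≤-refl 2≤3 i)

    sparing = gear-sparing 2 ≤-refl degree-rim₂ degree-mid₂ {S} rims-S mids-S (λ {u} {v} → independent {u} {v})

    even-case : 2 ∣ n → ∃[ φ ] IsSparingNumber (G ^ᴳ 2) φ × 2 * φ ≡ (n + 1) ^ 2 + 5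
    even-case 2∣n =
      let (φ , sp , eq) = sparing λ S′ ind →
            load₂-even-≤ (n ∸ 3) (χ (S′ hub)) (rims S′) (mids S′) k n≡3+[n∸3]
              (hub+rims≤1 2 ≤-refl S′ ind)
              (tighten-even (χ (S′ hub)) (mids S′) 2∣n
                (m+n≤o⇒n≤o (χ (S′ hub)) (hub+rims≤1 2 ≤-refl S′ ind))
                (hub+mids+rims≤n 2 ≤-refl S′ ind))
              2k+2≡n
      in φ , sp , φ₂-even k φ 2k+2≡n eq
      where
      2k+2≡n : 2 * k + 2 ≡ n
      2k+2≡n = trans (+-suc (2 * k) 1)
        (subst (λ b → suc (2 * k + χ (not b)) ≡ n) (2∣⇒¬odd 2∣n) (∑ᶠ-positiveEven 1≤n))

    odd-case : 2 ∤ n → ∃[ φ ] IsSparingNumber (G ^ᴳ 2) φ × 2 * φ ≡ (n + 1) ^ 2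
    odd-case 2∤n =
      let (φ , sp , eq) = sparing λ S′ ind →
            load₂-odd-≤ (n ∸ 3) (χ (S′ hub)) (rims S′) (mids S′) k n≡3+[n∸3]
              (hub+rims≤1 2 ≤-refl S′ ind) (hub+mids+rims≤n 2 ≤-refl S′ ind) 2k+1≡n
      in φ , sp , φ₂-odd k φ 2k+1≡n eq
      where
      2k+1≡n : 2 * k + 1 ≡ n
      2k+1≡n = trans (+-suc (2 * k) 0)
        (subst (λ b → suc (2 * k + χ (not b)) ≡ n) (2∤⇒odd 2∤n) (∑ᶠ-positiveEven 1≤n))

  -- Third power: alternate middle vertices

  module Cube where

    S : GearVertex n → Bool
    S hub     = false
    S (rim i) = false
    S (mid i) = odd (toℕ i)

    k : ℕ
    k = ∑ᶠ {n} (χ ∘ odd ∘ toℕ)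

    rims-S : rims S ≡ 0
    rims-S = trans (∑ᶠ-const n 0) (*-zeroʳ n)

    independent : Independent (G ^ᴳ 3) S
    independent {mid i} {mid j} e Si Sj with mid~mid⁻ ≤-refl e
    ... | inj₁ refl = odd-next i Si Sj
    ... | inj₂ refl = odd-next j Sj Si

    degree-rim₃ : ∀ i → degree (G ^ᴳ 3) (rim i) ≡ n + n
    degree-rim₃ i = degree-rim 3 2≤3 i (count-all (λ j → powerAdj? G 3 (rim i) (mid j)) (rim~mid₃ ≤-refl i))

    degree-mid₃ : ∀ i → degree (G ^ᴳ 3) (mid i) ≡ n + 3
    degree-mid₃ i = trans
      (degree-mid 3 2≤3 i
        (count-all (λ j → powerAdj? G 3 (mid i) (rim j)) (λ j → Graph.~-sym (G ^ᴳ 3) (rim~mid₃ ≤-refl j i)))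
        (count-mids 3 2≤3 ≤-refl i))
      (sym (+-suc n 2))

    -- Sums the clique inequality for {u, v₁, …, vₙ, wᵢ, wᵢ₊₁} over all i.
    constraint : ∀ S′ → Independent (G ^ᴳ 3) S′ →
                 n * (χ (S′ hub) + rims S′) + 2 * mids S′ ≤ n
    constraint S′ ind = begin
      n * t + 2 * mids S′
        ≡⟨ cong₂ _+_ (∑ᶠ-const n t) (∑-consecutive-mids S′) ⟨
      ∑ᶠ {n} (λ _ → t) + ∑ᶠ (λ i → χ (S′ (mid i)) + χ (S′ (mid (next i))))
        ≡⟨ ∑-distrib-+ {n} (λ _ → t) (λ i → χ (S′ (mid i)) + χ (S′ (mid (next i)))) ⟨
      ∑ᶠ (λ i → t + (χ (S′ (mid i)) + χ (S′ (mid (next i)))))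
        ≤⟨ ∑ᶠ≤n (λ i → subst (_≤ 1) (reassoc i) (clique-∑≤1 (G ^ᴳ 3) {S′} ind (clique i))) ⟩
      n ∎
      where
      t = χ (S′ hub) + rims S′

      reassoc : ∀ i → ∑ (mid i ∷ mid (next i) ∷ hub ∷ map rim (allFin n)) (χ ∘ S′) ≡
                      t + (χ (S′ (mid i)) + χ (S′ (mid (next i))))
      reassoc i = trans (cong (λ x → χ (S′ (mid i)) + (χ (S′ (mid (next i))) + x)) (∑-hub-rims S′))
                        (trans (sym (+-assoc (χ (S′ (mid i))) _ t)) (+-comm _ t))

      mid-clique : ∀ i → All (PowerAdj G 3 (mid i)) (hub ∷ map rim (allFin n))
      mid-clique i = Graph.~-sym (G ^ᴳ 3) (hub~mid 2≤3 i) ∷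
                     Allₚ.map⁺ (Allₚ.tabulate⁺ (λ j → Graph.~-sym (G ^ᴳ 3) (rim~mid₃ ≤-refl j i)))

      clique : ∀ i → AllPairs (PowerAdj G 3) (mid i ∷ mid (next i) ∷ hub ∷ map rim (allFin n))
      clique i = (mid~next 2≤3 i ∷ mid-clique i) ∷ mid-clique (next i) ∷ hub-clique 3 2≤3

    sparing = gear-sparing 3 2≤3 degree-rim₃ degree-mid₃ {S} rims-S refl (λ {u} {v} → independent {u} {v})

    even-case : 2 ∣ n → IsSparingNumber (G ^ᴳ 3) (n * (n + 1))
    even-case 2∣n =
      let (φ , sp , eq) = sparing λ S′ ind →
            load₃-even-≤ (n ∸ 3) (χ (S′ hub)) (rims S′) (mids S′) k n≡3+[n∸3]
              (constraint S′ ind) 2k≡n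
      in subst (IsSparingNumber (G ^ᴳ 3)) (φ₃-even k φ 2k≡n eq) sp
      where
      2k≡n : 2 * k ≡ n
      2k≡n = trans (sym (+-identityʳ (2 * k))) (subst (λ b → 2 * k + χ b ≡ n) (2∣⇒¬odd 2∣n) (∑ᶠ-odd n))

    odd-case : 2 ∤ n → ∃[ φ ] IsSparingNumber (G ^ᴳ 3) φ × 2 * φ ≡ 2 * n ^ 2 + 3 * n + 3
    odd-case 2∤n =
      let (φ , sp , eq) = sparing λ S′ ind →
            load₃-odd-≤ (n ∸ 3) (χ (S′ hub)) (rims S′) (mids S′) k n≡3+[n∸3]
              (tighten-odd (mids S′) 2∤n (hub+rims≤1 3 2≤3 S′ ind) (constraint S′ ind)) 2k+1≡n
      in φ , sp , φ₃-odd k φ 2k+1≡n eq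
      where
      2k+1≡n : 2 * k + 1 ≡ n
      2k+1≡n = subst (λ b → 2 * k + χ b ≡ n) (2∤⇒odd 2∤n) (∑ᶠ-odd n)

  -- Fourth power: a complete graph

  module Fourth where

    S : GearVertex n → Bool
    S hub     = true
    S (rim i) = false
    S (mid i) = false

    independent : Independent (G ^ᴳ 4) S
    independent {hub} {hub} (v≢v , _) _ _ = v≢v refl

    complete-graph : ∀ {u v} → u ≢ v → PowerAdj G 4 u v
    complete-graph {hub}   {hub}   v≢v = contradiction refl v≢v
    complete-graph {hub}   {rim j} _   = hub~rim (s≤s z≤n) j
    complete-graph {hub}   {mid j} _   = hub~mid 2≤4 j
    complete-graph {rim i} {hub}   _   = Graph.~-sym (G ^ᴳ 4) (hub~rim (s≤s z≤n) i)
    complete-graph {rim i} {rim j} i≢j = rim~rim 2≤4 (i≢j ∘ cong rim)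
    complete-graph {rim i} {mid j} _   = rim~mid₃ (n≤1+n 3) i j
    complete-graph {mid i} {hub}   _   = Graph.~-sym (G ^ᴳ 4) (hub~mid 2≤4 i)
    complete-graph {mid i} {rim j} _   = Graph.~-sym (G ^ᴳ 4) (rim~mid₃ (n≤1+n 3) j i)
    complete-graph {mid i} {mid j} i≢j = mid~mid₄ ≤-refl (i≢j ∘ cong mid)

    degree-rim₄ : ∀ i → degree (G ^ᴳ 4) (rim i) ≡ n + n
    degree-rim₄ i = degree-rim 4 2≤4 i
      (count-all (λ j → powerAdj? G 4 (rim i) (mid j)) (λ j → complete-graph λ ()))

    degree-mid₄ : ∀ i → degree (G ^ᴳ 4) (mid i) ≡ n + n
    degree-mid₄ i = trans
      (degree-mid 4 2≤4 i
        (count-all (λ j → powerAdj? G 4 (mid i) (rim j)) (λ j → complete-graph λ ())) refl)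
      -- The hub makes up for the missing `mid i`.
      (trans (sym (+-suc n _)) (cong (n +_)
        (count-≢ (λ j → powerAdj? G 4 (mid i) (mid j)) i
          (λ j → mk⇔ (λ e → proj₁ e ∘ cong mid) (λ i≢j → complete-graph (i≢j ∘ mid-injective))))))

    -- The whole vertex set is one clique and all degrees equal 2n, so the hub is as good as any
    -- other vertex.
    maximal : ∀ S′ → Independent (G ^ᴳ 4) S′ →
              load n (n + n) (n + n) (χ (S′ hub)) (rims S′) (mids S′) ≤
              load n (n + n) (n + n) 1 0 0
    maximal S′ ind = begin
      χ (S′ hub) * (n + n) + (rims S′ * (n + n) + mids S′ * (n + n))
        ≡⟨ cong (χ (S′ hub) * (n + n) +_) (*-distribʳ-+ (n + n) (rims S′) _) ⟨
      χ (S′ hub) * (n + n) + (rims S′ + mids S′) * (n + n)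
        ≡⟨ *-distribʳ-+ (n + n) (χ (S′ hub)) _ ⟨
      (χ (S′ hub) + (rims S′ + mids S′)) * (n + n)
        ≤⟨ *-monoˡ-≤ (n + n) (subst (_≤ 1) (∑-gear n (χ ∘ S′))
             (clique-∑≤1 (G ^ᴳ 4) {S′} ind (AllPairs.map complete-graph (gearVertices-unique n)))) ⟩
      1 * (n + n)
        ≡⟨ +-identityʳ (1 * (n + n)) ⟨
      1 * (n + n) + (0 * (n + n) + 0 * (n + n)) ∎

    case : IsSparingNumber (G ^ᴳ 4) (n * (2 * n ∸ 1))
    case =
      let (φ , sp , eq) = gear-sparing 4 2≤4 degree-rim₄ degree-mid₄ {S} none none
                            (λ {u} {v} → independent {u} {v}) maximal
      in subst (IsSparingNumber (G ^ᴳ 4)) (φ₄ φ n≥3 eq) sp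
      where
      none : ∑ᶠ {n} (λ _ → 0) ≡ 0
      none = trans (∑ᶠ-const n 0) (*-zeroʳ n)

mainTheorem10 : (n : ℕ) (n≥3 : 3 ≤ n) →
    ((2 ∣ n → ∃[ φ ] IsSparingNumber (gear n n≥3 ^ᴳ 2) φ × 2 * φ ≡ (n + 1) ^ 2 + 5) ×
    (2 ∤ n → ∃[ φ ] IsSparingNumber (gear n n≥3 ^ᴳ 2) φ × 2 * φ ≡ (n + 1) ^ 2)) ×
    ((2 ∣ n → IsSparingNumber (gear n n≥3 ^ᴳ 3) (n * (n + 1))) ×
    (2 ∤ n → ∃[ φ ] IsSparingNumber (gear n n≥3 ^ᴳ 3) φ × 2 * φ ≡ 2 * n ^ 2 + 3 * n + 3)) ×
    IsSparingNumber (gear n n≥3 ^ᴳ 4) (n * (2 * n ∸ 1))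
mainTheorem10 n n≥3 =
  (Square.even-case n n≥3 , Square.odd-case n n≥3) ,
  (Cube.even-case n n≥3 , Cube.odd-case n n≥3) ,
  Fourth.case n n≥3
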